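{- Let $a,b,c$ be positive integers, $R = \mathbb{Z}[x,y,z]/(x^{a+b},y^{a+c},z^{b+c})$ with its standard grading, and $m := a+b+c-2$. Let $U_m : R_m \to R_{m+1}$ be multiplication by $x+y+z$, written as a matrix with respect to the monomial $\mathbb{Z}$-bases of $R_m$ and $R_{m+1}$ (the nonzero monomials of degrees $m$ and $m+1$). Then $U_m$ is a square $0$-$1$ matrix, $\det(U_m) = \pm \operatorname{perm}(U_m)$, and the nonzero terms of the permanent $\operatorname{perm}(U_m)=\sum_\varphi \prod_{\lambda} (U_m)_{\lambda,\varphi(\lambda)}$ (equivalently, the perfect matchings between degree-$m$ and degree-$(m+1)$ monomials in which matched monomials differ by a factor of one variable) are in bijection with the plane partitions fitting in an $a\times b\times c$ box. In particular, $|\det(U_m)|$ equals the number of plane partitions fitting in an $a\times b\times c$ box.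
   Context: A plane partition fitting in an $a \times b \times c$ box is an array $(\pi_{i,j})_{1\le i\le a,\,1\le j\le b}$ of integers in $\{0,1,\dots,c\}$ that is weakly decreasing along each row and each column. -}

module Defs where

open import Data.Nat as ℕ using (ℕ; zero; suc; _+_; _∸_; _≤ᵇ_; _<ᵇ_; _≡ᵇ_)
open import Data.Integer as ℤ using (ℤ; +_; -_)
open import Data.Bool using (Bool; true; false; if_then_else_; _∧_; _∨_; not; T)
open import Data.Fin as Fin using (Fin; toℕ)
open import Data.Vec as Vec using (Vec; []; _∷_; lookup)
open import Data.List as List using (List; []; _∷_; [_]; map; concatMap; upTo; allFin; filterᵇ; length; foldr)
open import Data.Product using (Σ; _×_; _,_)
open import Relation.Binary.PropositionalEquality using (_≡_)
open import Relation.Nullary using (does)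

-- Monomials of R = ℤ[x,y,z]/(x^(a+b), y^(a+c), z^(b+c))
-- A monomial x^i y^j z^k is the triple (i , j , k).

all : {A : Set} → (A → Bool) → List A → Bool
all p = foldr (λ x r → p x ∧ r) true

sumℕ : List ℕ → ℕ
sumℕ = foldr _+_ 0

Monomial : Set
Monomial = ℕ × ℕ × ℕ

-- The nonzero monomials of degree d in R (i < a+b, j < a+c, k < b+c,
-- i+j+k = d), listed in lexicographic order.  This is the monomial
-- ℤ-basis of R_d.
basis : ℕ → ℕ → ℕ → ℕ → List Monomial
basis a b c d =
  concatMap (λ i →
    concatMap (λ j →
      map (λ k → (i , j , k))
        (filterᵇ (λ k → (i + j + k) ≡ᵇ d) (upTo (b + c))))
      (upTo (a + c)))
    (upTo (a + b))

eqMon : Monomial → Monomial → Bool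
eqMon (i , j , k) (i′ , j′ , k′) = (i ≡ᵇ i′) ∧ ((j ≡ᵇ j′) ∧ (k ≡ᵇ k′))

boolℤ : Bool → ℤ
boolℤ true  = + 1
boolℤ false = + 0

-- Coefficient of the basis monomial μ in (x + y + z) · λ.
-- (If λ·x vanishes in R it is not equal to any basis monomial, so it
-- contributes 0, as it should.)
coeffMul : Monomial → Monomial → ℤ
coeffMul (i , j , k) μ =
  boolℤ (eqMon (suc i , j , k) μ) ℤ.+
  (boolℤ (eqMon (i , suc j , k) μ) ℤ.+ boolℤ (eqMon (i , j , suc k) μ))

deg : ℕ → ℕ → ℕ → ℕ
deg a b c = a + b + c ∸ 2

rowsN : ℕ → ℕ → ℕ → ℕ
rowsN a b c = length (basis a b c (deg a b c))

colsN : ℕ → ℕ → ℕ → ℕ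
colsN a b c = length (basis a b c (suc (deg a b c)))

U : (a b c : ℕ) → Fin (rowsN a b c) → Fin (colsN a b c) → ℤ
U a b c r s =
  coeffMul (List.lookup (basis a b c (deg a b c)) r)
           (List.lookup (basis a b c (suc (deg a b c))) s)

Usq : (a b c : ℕ) → rowsN a b c ≡ colsN a b c →
      Fin (rowsN a b c) → Fin (rowsN a b c) → ℤ
Usq a b c e r s = U a b c r (Fin.cast e s)

Matrix : ℕ → Set
Matrix n = Fin n → Fin n → ℤ

allVecs : (n k : ℕ) → List (Vec (Fin n) k)
allVecs n zero    = [ [] ]
allVecs n (suc k) = concatMap (λ i → map (i ∷_) (allVecs n k)) (allFin n)

eqFin : {n : ℕ} → Fin n → Fin n → Bool
eqFin i j = toℕ i ≡ᵇ toℕ j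

isPermᵇ : {n : ℕ} → Vec (Fin n) n → Bool
isPermᵇ {n} σ =
  all (λ i → all (λ j → eqFin i j ∨ not (eqFin (lookup σ i) (lookup σ j)))
                 (allFin n))
      (allFin n)

perms : (n : ℕ) → List (Vec (Fin n) n)
perms n = filterᵇ isPermᵇ (allVecs n n)

countᵇ : {A : Set} → (A → Bool) → List A → ℕ
countᵇ p xs = length (filterᵇ p xs)

inversions : {n : ℕ} → Vec (Fin n) n → ℕ
inversions {n} σ =
  sumℕ (map (λ i → countᵇ (λ j → (toℕ i <ᵇ toℕ j) ∧
                                       (toℕ (lookup σ j) <ᵇ toℕ (lookup σ i)))
                              (allFin n))
                (allFin n))

minusOnePow : ℕ → ℤ
minusOnePow zero    = + 1
minusOnePow (suc k) = - minusOnePow k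

sign : {n : ℕ} → Vec (Fin n) n → ℤ
sign σ = minusOnePow (inversions σ)

sumℤ : List ℤ → ℤ
sumℤ = foldr ℤ._+_ (+ 0)

prodℤ : List ℤ → ℤ
prodℤ = foldr ℤ._*_ (+ 1)

term : {n : ℕ} → Matrix n → Vec (Fin n) n → ℤ
term {n} M σ = prodℤ (map (λ i → M i (lookup σ i)) (allFin n))

det : {n : ℕ} → Matrix n → ℤ
det {n} M = sumℤ (map (λ σ → sign σ ℤ.* term M σ) (perms n))

perm : {n : ℕ} → Matrix n → ℤ
perm {n} M = sumℤ (map (term M) (perms n))

NonzeroTerm : {n : ℕ} → Matrix n → Set
NonzeroTerm {n} M =
  Σ (Vec (Fin n) n) λ σ → T (isPermᵇ σ ∧ not (does (term M σ ℤ.≟ + 0)))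

Array : ℕ → ℕ → Set
Array a b = Vec (Vec ℕ b) a

entry : {a b : ℕ} → Array a b → Fin a → Fin b → ℕ
entry π i j = lookup (lookup π i) j

isPPᵇ : {a b : ℕ} → ℕ → Array a b → Bool
isPPᵇ {a} {b} c π =
  all (λ i → all (λ j →
      (entry π i j ≤ᵇ c) ∧
      (all (λ j′ → not (toℕ j ≤ᵇ toℕ j′) ∨ (entry π i j′ ≤ᵇ entry π i j)) (allFin b) ∧
       all (λ i′ → not (toℕ i ≤ᵇ toℕ i′) ∨ (entry π i′ j ≤ᵇ entry π i j)) (allFin a)))
    (allFin b)) (allFin a)

PlanePartition : ℕ → ℕ → ℕ → Set
PlanePartition a b c = Σ (Array a b) λ π → T (isPPᵇ c π)

allVecsℕ : (c k : ℕ) → List (Vec ℕ k)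
allVecsℕ c zero    = [ [] ]
allVecsℕ c (suc k) = concatMap (λ v → map (v ∷_) (allVecsℕ c k)) (upTo (suc c))

allArrays : (c a b : ℕ) → List (Array a b)
allArrays c zero    b = [ [] ]
allArrays c (suc a) b =
  concatMap (λ r → map (r ∷_) (allArrays c a b)) (allVecsℕ c b)

numPP : ℕ → ℕ → ℕ → ℕ
numPP a b c = countᵇ (isPPᵇ c) (allArrays c a b)

{-# OPTIONS --safe #-}

-- Cut the hexagon of monomials into levels by the exponent i of x.  A matching is a choice of a
-- direction X, Y or Z at every monomial of degree m; outside the hexagon (but with i < a + b and
-- j < a + c) we let every point move in direction X.  Counting the x-edges that enter level i to
-- the left of column j gives a height function N i j, and the matching condition becomes
--   N (i+1) j ≤ N (i+1) (j+1) ≤ N i (j+1) ≤ 1 + N (i+1) j,   N 0 j = min j a,   N (a+b) j = j - c.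
-- The direction at (i , j) says which of the three inequalities is strict, so matchings are height
-- functions.  The x-edges entering level i, listed from left to right, are the entries π_{p,q} of a
-- diagonal a + q = i + p of a plane partition, at column j = p + c - π_{p,q}; hence
--   p < N i j  ⇔  c + p < j + π_{p,q},
-- and the inequalities for N say that π decreases along rows and columns.
--
-- For the sign: in the lexicographic order an inversion always starts at an x-edge and ends at a y-
-- or z-edge, so the x-edge at r starts exactly σ(r) - r inversions.  As degree m + 1 at level i + 1
-- is a copy of degree m at level i, this difference is the size d of level 0 in degree m + 1.  So
-- all matchings have the same number of inversions, d times the total increase of the x-exponent.

module Submission where

open import Defs
open import Data.Nat using (ℕ; zero; suc; pred; _+_; _*_; _∸_; _⊓_; _≤_; _<_; z≤n; s≤s; z<s; s≤s⁻¹; _≡ᵇ_; _<ᵇ_; _≤ᵇ_; _<?_; _≤?_; _≟_; >-nonZero)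
open import Data.Nat.Properties
open import Data.Nat.Tactic.RingSolver using (solve)
open import Data.Bool using (Bool; true; false; T; _∧_; _∨_; not)
open import Data.Bool.Properties using (T?; T-irrelevant; ∧-zeroʳ)
open import Data.Fin as Fin using (Fin; toℕ; fromℕ<; punchOut)
open import Data.Fin.Permutation using (Permutation; permutation)
open import Data.Fin.Properties as Finₚ using (toℕ-injective; toℕ<n; toℕ-fromℕ<; toℕ-cast; cast-involutive; injective⇒≤; punchOut-injective; any?)
open import Data.List as List using (List; []; _∷_; [_]; _++_; map; concatMap; upTo; allFin; filterᵇ; length; cartesianProductWith)
open import Data.List.Properties using (concatMap-cong; concatMap-map; map-concatMap; concatMap-++; upTo-∷ʳ; map-upTo; map-∘)
open import Data.List.Membership.Propositional using (_∈_; _∉_; find; lose)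
open import Data.List.Membership.Propositional.Properties
open import Data.List.Membership.DecPropositional as DecMembership using ()
open import Data.List.Relation.Unary.All as All using ()
open import Data.List.Relation.Unary.All.Properties as Allₚ using ()
open import Data.List.Relation.Unary.AllPairs as AllPairs using (AllPairs; []; _∷_)
open import Data.List.Relation.Unary.AllPairs.Properties as AllPairsₚ using ()
open import Data.List.Relation.Unary.Any using (here; there; index)
open import Data.List.Relation.Unary.Any.Properties using (lookup-index)
open import Data.List.Relation.Unary.Unique.Propositional using (Unique)
open import Data.List.Relation.Unary.Unique.Propositional.Properties as Uniqueₚ using ()
open import Data.Product using (Σ; ∃; ∃₂; _×_; _,_; proj₁; proj₂)
open import Data.Product.Properties using (≡-dec)
open import Data.Sum using (_⊎_; inj₁; inj₂)
open import Data.Empty using (⊥; ⊥-elim)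
open import Data.Unit using (tt)
open import Function using (_∘_)
open import Function.Bundles using (_⤖_; mk⤖; Bijection)
open import Function.Consequences.Propositional using (strictlySurjective⇒surjective)
open import Relation.Nullary using (¬_; yes; no; does)
open import Relation.Binary.Definitions using (DecidableEquality; tri<; tri≈; tri>)
open import Relation.Binary.PropositionalEquality using (_≡_; _≢_; refl; sym; trans; cong; cong₂; subst; subst₂)
open import Algebra.Properties.CommutativeMonoid.Sum +-0-commutativeMonoid using (sum; sum-cong-≗; ∑-distrib-+; sum-permute; sum-replicate-zero)

-- Counting and height functions

-- Certificates for linear arithmetic: X ≤ Y is a sum of hypotheses (see _⊕_), s the slack, and the
-- identity is left to the ring solver.
lin : ∀ s {x y X Y} → X ≤ Y → x + Y + s ≡ y + X → x ≤ y
lin s {x} {y} {X} {Y} h e =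
  +-cancelʳ-≤ X x y (≤-trans (+-monoʳ-≤ x h) (≤-trans (m≤m+n (x + Y) s) (≤-reflexive e)))

infixl 6 _⊕_
_⊕_ : ∀ {x y u v} → x ≤ y → u ≤ v → x + u ≤ y + v
_⊕_ = +-mono-≤

≤-by-< : ∀ {x y} → (∀ p → p < x → p < y) → x ≤ y
≤-by-< {zero}  h = z≤n
≤-by-< {suc x} h = h x ≤-refl

bit : Bool → ℕ
bit true  = 1
bit false = 0

bit≤1 : ∀ b → bit b ≤ 1
bit≤1 true  = ≤-refl
bit≤1 false = z≤n

cnt : (ℕ → Bool) → ℕ → ℕ
cnt P zero    = 0
cnt P (suc n) = bit (P n) + cnt P n

cnt≤ : ∀ P n → cnt P n ≤ n
cnt≤ P zero    = z≤n
cnt≤ P (suc n) = bit≤1 (P n) ⊕ cnt≤ P n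

cnt-cong : ∀ {P Q} n → (∀ x → x < n → P x ≡ Q x) → cnt P n ≡ cnt Q n
cnt-cong zero    h = refl
cnt-cong (suc n) h = cong₂ (λ u v → bit u + v) (h n ≤-refl) (cnt-cong n λ x x<n → h x (m≤n⇒m≤1+n x<n))

shift-∸ : ∀ c {p j} → c + p ≤ j → p ≤ j ∸ c
shift-∸ c {p} h = subst (_≤ _) (m+n∸m≡n c p) (∸-monoˡ-≤ c h)

unshift-∸ : ∀ c {p j} → p < j ∸ c → c + suc p ≤ j
unshift-∸ zero            h = h
unshift-∸ (suc c) {j = suc j} h = s≤s (unshift-∸ c h)

-- The points counted by a downward closed predicate form an initial segment, so `x < cnt P k` holds
-- just when `x < k` and `P x`. Heights and entries below are such counts, and `≤-by-<` compares
-- them one threshold at a time.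
module DownClosed (P : ℕ → Bool) (n : ℕ) (down : ∀ x → suc x < n → T (P (suc x)) → T (P x)) where

  below : ∀ {y} → y < n → T (P y) → ∀ {x} → x ≤ y → T (P x)
  below y<n Py x≤y with m≤n⇒∃[o]m+o≡n x≤y
  ... | o , refl = go o y<n Py
    where
    go : ∀ {x} o → x + o < n → T (P (x + o)) → T (P x)
    go {x} zero    _ Py = subst (T ∘ P) (+-identityʳ x) Py
    go {x} (suc o) lt Py =
      go o (<-trans (≤-reflexive (sym (+-suc x o))) lt)
          (down (x + o) (subst (_< n) (+-suc x o) lt) (subst (T ∘ P) (+-suc x o) Py))

  cnt⁻ : ∀ k → k ≤ n → ∀ {x} → x < cnt P k → x < k × T (P x)
  cnt⁻ (suc k) k<n {x} x< with P k in eq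
  ... | true  = x<1+k , below k<n (subst T (sym eq) tt) (s≤s⁻¹ x<1+k)
    where
    x<1+k : x < suc k
    x<1+k = ≤-trans x< (s≤s (cnt≤ P k))
  ... | false with cnt⁻ k (<⇒≤ k<n) x<
  ...   | x<k , Px = m≤n⇒m≤1+n x<k , Px

  cnt⁺ : ∀ k → k ≤ n → ∀ {x} → x < k → T (P x) → x < cnt P k
  cnt⁺ (suc k) k<n {x} x<1+k Px with m≤n⇒m<n∨m≡n (s≤s⁻¹ x<1+k)
  ... | inj₁ x<k = ≤-trans (cnt⁺ k (<⇒≤ k<n) x<k Px) (m≤n+m (cnt P k) (bit (P k)))
  ... | inj₂ refl = ≤-trans (s≤s (≤-by-< λ p p<k → cnt⁺ k (<⇒≤ k<n) p<k (below k<n Px (<⇒≤ p<k))))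
                            (+-monoˡ-≤ (cnt P k) (T⇒1≤ (P k) Px))
    where
    T⇒1≤ : ∀ b → T b → 1 ≤ bit b
    T⇒1≤ true _ = ≤-refl

module Heights (a b c : ℕ) where

  record IsHeight (N : ℕ → ℕ → ℕ) : Set where
    field
      mono  : ∀ {i j} → i ≤ a + b → j < a + c → N i j ≤ N i (suc j)
      anti  : ∀ {i j} → i < a + b → j ≤ a + c → N (suc i) j ≤ N i j
      step  : ∀ {i j} → i < a + b → j < a + c → N i (suc j) ≤ suc (N (suc i) j)
      start : ∀ {j} → j ≤ a + c → N 0 j ≡ j ⊓ a
      end   : ∀ {j} → j ≤ a + c → N (a + b) j ≡ j ∸ c

    mono* : ∀ {i j j′} → i ≤ a + b → j ≤ j′ → j′ ≤ a + c → N i j ≤ N i j′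
    mono* i≤ j≤j′ j′≤ with m≤n⇒∃[o]m+o≡n j≤j′
    ... | o , refl = go o j′≤
      where
      go : ∀ {j} o → j + o ≤ a + c → N _ j ≤ N _ (j + o)
      go {j} zero    _ = ≤-reflexive (cong (N _) (sym (+-identityʳ j)))
      go {j} (suc o) h = ≤-trans (go o (<⇒≤ h′)) (≤-trans (mono i≤ h′)
          (≤-reflexive (cong (N _) (sym (+-suc j o)))))
        where
        h′ : j + o < a + c
        h′ = subst (_≤ a + c) (+-suc j o) h

    anti* : ∀ {i i′ j} → i ≤ i′ → i′ ≤ a + b → j ≤ a + c → N i′ j ≤ N i j
    anti* {j = j} i≤i′ i′≤ j≤ with m≤n⇒∃[o]m+o≡n i≤i′
    ... | o , refl = go o i′≤
      where
      go : ∀ {i} o → i + o ≤ a + b → N (i + o) j ≤ N i j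
      go {i} zero    _ = ≤-reflexive (cong (λ u → N u j) (+-identityʳ i))
      go {i} (suc o) h = ≤-trans (≤-reflexive (cong (λ u → N u j) (+-suc i o)))
          (≤-trans (anti h′ j≤) (go o (<⇒≤ h′)))
        where
        h′ : i + o < a + b
        h′ = subst (_≤ a + b) (+-suc i o) h

    N≤⊓ : ∀ {i j} → i ≤ a + b → j ≤ a + c → N i j ≤ j ⊓ a
    N≤⊓ i≤ j≤ = ≤-trans (anti* z≤n i≤ j≤) (≤-reflexive (start j≤))

    N≤j : ∀ {i j} → i ≤ a + b → j ≤ a + c → N i j ≤ j
    N≤j {i} {j} i≤ j≤ = ≤-trans (N≤⊓ i≤ j≤) (m⊓n≤m j a)

    N≤a : ∀ {i j} → i ≤ a + b → j ≤ a + c → N i j ≤ a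
    N≤a {i} {j} i≤ j≤ = ≤-trans (N≤⊓ i≤ j≤) (m⊓n≤n j a)

    ∸c≤N : ∀ {i j} → i ≤ a + b → j ≤ a + c → j ∸ c ≤ N i j
    ∸c≤N i≤ j≤ = ≤-trans (≤-reflexive (sym (end j≤))) (anti* i≤ ≤-refl j≤)

    -- Outside the hexagon a height function is forced (low, high).
    low : ∀ i j → i + j ≤ a → j ≤ N i j
    low zero    j h = ≤-reflexive (sym (trans (start (m≤n⇒m≤n+o c h)) (m≤n⇒m⊓n≡m h)))
    low (suc i) j h = s≤s⁻¹ (≤-trans (low i (suc j) (subst (_≤ a) (sym (+-suc i j)) h))
      (step (lin (j + b) h (solve (i ∷ j ∷ a ∷ b ∷ []))) (lin (i + c) h (solve (i ∷ j ∷ a ∷ c ∷ [])))))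

    -- Each use of `step` goes one level on and one column back at the cost of one; after `e` uses
    -- the last level is reached, where `end` gives the height.
    high-steps : ∀ e {i} j → i + e ≡ a + b → e + j ≤ a + c → N i (e + j) ≤ e + (j ∸ c)
    high-steps zero {i} j eq h = ≤-reflexive (trans (cong (λ u → N u j) (trans (sym (+-identityʳ i)) eq))
        (end h))
    high-steps (suc e) {i} j eq h = ≤-trans (step (subst (i <_) eq (m<m+n i z<s)) h)
      (s≤s (high-steps e j (trans (sym (+-suc i e)) eq) (<⇒≤ h)))

    high : ∀ {i j} → i ≤ a + b → j ≤ a + c → a + b + c ≤ i + j → N i j ≤ j ∸ c
    high {i} i≤ j≤ h with m≤n⇒∃[o]m+o≡n i≤
    high {i} {j} i≤ j≤ h | e , eq with m≤n⇒∃[o]m+o≡n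
        (+-cancelˡ-≤ i (e + c) j (≤-trans (≤-reflexive (trans (sym (+-assoc i e c)) (cong (_+ c) eq))) h))
    -- Here `j` is `e + c + o`, with `e` the number of levels left; `high-steps` towards column
    -- `c + o` gives the bound `e + o`, which is `j ∸ c`.
    ... | o , refl = ≤-trans (≤-reflexive (cong (N i) (+-assoc e c o)))
       (≤-trans (high-steps e (c + o) eq (≤-trans (≤-reflexive (sym (+-assoc e c o))) j≤))
       (≤-reflexive (trans (cong (e +_) (m+n∸m≡n c o))
           (sym (trans (cong (_∸ c) {e + c + o} {c + (e + o)} (solve (e ∷ c ∷ o ∷ []))) (m+n∸m≡n c (e + o)))))))

  -- Row p of a plane partition, continued by c to the left and 0 to the right; u = a + q.
  ext : (ℕ → ℕ → ℕ) → ℕ → ℕ → ℕ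
  ext g p u with u <? a
  ... | yes _ = c
  ... | no _ with u ∸ a <? b
  ...   | yes _ = g p (u ∸ a)
  ...   | no _  = 0

  ext-left : ∀ g p {u} → u < a → ext g p u ≡ c
  ext-left g p {u} h with u <? a
  ... | yes _ = refl
  ... | no ¬h = ⊥-elim (¬h h)

  ext-mid : ∀ g p {q} → q < b → ext g p (a + q) ≡ g p q
  ext-mid g p {q} h with a + q <? a
  ... | yes h′ = ⊥-elim (m+n≮m a q h′)
  ... | no _ with a + q ∸ a <? b
  ...   | yes _ = cong (g p) (m+n∸m≡n a q)
  ...   | no ¬h = ⊥-elim (¬h (subst (_< b) (sym (m+n∸m≡n a q)) h))

  ext-right : ∀ g p {q} → b ≤ q → ext g p (a + q) ≡ 0
  ext-right g p {q} h with a + q <? a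
  ... | yes h′ = ⊥-elim (m+n≮m a q h′)
  ... | no _ with a + q ∸ a <? b
  ...   | yes h′ = ⊥-elim (≤⇒≯ h (subst (_< b) (m+n∸m≡n a q) h′))
  ...   | no _ = refl

  data Zone : ℕ → Set where
    left  : ∀ {u} → u < a → Zone u
    mid   : ∀ q → q < b → Zone (a + q)
    right : ∀ q → b ≤ q → Zone (a + q)

  zone : ∀ u → Zone u
  zone u with u <? a
  ... | yes h = left h
  ... | no ¬h with m≤n⇒∃[o]m+o≡n (≮⇒≥ ¬h)
  ...   | q , refl with q <? b
  ...     | yes h = mid q h
  ...     | no ¬h′ = right q (≮⇒≥ ¬h′)

  -- Rows p ≥ a are included: there g vanishes.
  record IsPP (g : ℕ → ℕ → ℕ) : Set where
    field
      bounded : ∀ p {q} → q < b → g p q ≤ c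
      row     : ∀ p {q} → suc q < b → g p (suc q) ≤ g p q
      column  : ∀ p {q} → q < b → g (suc p) q ≤ g p q

    ext-row : ∀ p u → ext g p (suc u) ≤ ext g p u
    ext-row p u with zone u
    ext-row p u | left h with m≤n⇒m<n∨m≡n h
    ... | inj₁ h′ = ≤-reflexive (trans (ext-left g p h′) (sym (ext-left g p h)))
    ... | inj₂ refl with 0 <? b
    ...   | yes 0<b = subst₂ _≤_ (trans (sym (ext-mid g p 0<b)) (cong (ext g p) (+-identityʳ a)))
        (sym (ext-left g p h)) (bounded p 0<b)
    ...   | no ¬0<b = subst (_≤ ext g p u) (trans (sym (ext-right g p (≮⇒≥ ¬0<b)))
        (cong (ext g p) (+-identityʳ a))) z≤n
    ext-row p .(a + q) | mid q h with suc q <? b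
    ... | yes h′ = subst₂ _≤_ (trans (sym (ext-mid g p h′)) (cong (ext g p) (+-suc a q))) (sym (ext-mid g p h))
        (row p h′)
    ... | no ¬h′ = subst (_≤ ext g p (a + q)) (trans (sym (ext-right g p (≮⇒≥ ¬h′)))
        (cong (ext g p) (+-suc a q))) z≤n
    ext-row p .(a + q) | right q h =
      subst (_≤ ext g p (a + q)) (trans (sym (ext-right g p (m≤n⇒m≤1+n h))) (cong (ext g p) (+-suc a q))) z≤n

    ext-column : ∀ p u → ext g (suc p) u ≤ ext g p u
    ext-column p u with zone u
    ... | left h    = ≤-reflexive (trans (ext-left g (suc p) h) (sym (ext-left g p h)))
    ... | mid q h   = subst₂ _≤_ (sym (ext-mid g (suc p) h)) (sym (ext-mid g p h)) (column p h)
    ... | right q h = ≤-reflexive (trans (ext-right g (suc p) h) (sym (ext-right g p h)))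

  heightᵇ : (ℕ → ℕ → ℕ) → ℕ → ℕ → ℕ → Bool
  heightᵇ g i j p = c + p <ᵇ j + ext g p (i + p)

  height : (ℕ → ℕ → ℕ) → ℕ → ℕ → ℕ
  height g i j = cnt (heightᵇ g i j) a

  module PPToHeight {g : ℕ → ℕ → ℕ} (π : IsPP g) where
    open IsPP π

    E : ℕ → ℕ → ℕ
    E p i = ext g p (i + p)

    E-row : ∀ p i → E p (suc i) ≤ E p i
    E-row p i = ext-row p (i + p)

    -- The index `i + suc p` is `suc i + p`, so row `suc p` on level `i` and row `p` on level
    -- `suc i` lie in the same column.
    E-column : ∀ p i → E (suc p) i ≤ E p (suc i)
    E-column p i = ≤-trans (≤-reflexive (cong (ext g (suc p)) (+-suc i p))) (ext-column p (suc i + p))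

    -- `E-column` followed by `E-row` bounds `E (suc p) i` by `E p i`, while `c + p` grows with `p`;
    -- hence the rows counted by `height` form an initial segment.
    E-down : ∀ i j p → c + suc p < j + E (suc p) i → c + p < j + E p i
    E-down i j p h = lin 1 (h ⊕ E-column p i ⊕ E-row p i) (identity (E p i) (E p (suc i)) (E (suc p) i))
      where
      identity : ∀ x y z → suc (c + p) + (j + z + y + x) + 1 ≡ j + x + (suc (c + suc p) + z + y)
      identity x y z = solve (x ∷ y ∷ z ∷ p ∷ j ∷ c ∷ [])

    private
      module DC i j = DownClosed (heightᵇ g i j) a
          (λ p _ h → <⇒<ᵇ (E-down i j p (<ᵇ⇒< (c + suc p) (j + E (suc p) i) h)))

    height⁺ : ∀ i j {p} → p < a → c + p < j + E p i → p < height g i j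
    height⁺ i j p<a h = DC.cnt⁺ i j a ≤-refl p<a (<⇒<ᵇ h)

    height⁻ : ∀ i j {p} → p < height g i j → p < a × c + p < j + E p i
    height⁻ i j {p} h with DC.cnt⁻ i j a ≤-refl h
    ... | p<a , h′ = p<a , <ᵇ⇒< (c + p) (j + E p i) h′

    -- Level 0 meets row `p` at index `p < a`, in the left extension by `c`; cancelling `c` leaves
    -- `p < j`.
    height-start : ∀ j → height g 0 j ≡ j ⊓ a
    height-start j = ≤-antisym
      (≤-by-< λ p h → let p<a , h′ = height⁻ 0 j h in
         ⊓-glb (+-cancelˡ-≤ c (suc p) j (subst₂ _≤_ (sym (+-suc c p))
             (trans (cong (j +_) (ext-left g p p<a)) (+-comm j c)) h′)) p<a)
      (≤-by-< λ p h → let p<a = ≤-trans h (m⊓n≤n j a) in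
         height⁺ 0 j p<a (subst₂ _≤_ (+-suc c p) (sym (trans (cong (j +_) (ext-left g p p<a)) (+-comm j c)))
             (+-monoʳ-≤ c (≤-trans h (m⊓n≤m j a)))))

    E-end : ∀ p → E p (a + b) ≡ 0
    E-end p = trans (cong (ext g p) (+-assoc a b p)) (ext-right g p (m≤m+n b p))

    height-end : ∀ {j} → j ≤ a + c → height g (a + b) j ≡ j ∸ c
    height-end {j} j≤ = ≤-antisym
      (≤-by-< λ p h → let p<a , h′ = height⁻ (a + b) j h in
         shift-∸ c (subst₂ _≤_ (sym (+-suc c p)) (trans (cong (j +_) (E-end p)) (+-identityʳ j)) h′))
      (≤-by-< λ p h →
         height⁺ (a + b) j (≤-trans h (≤-trans (∸-monoˡ-≤ c j≤) (≤-reflexive (m+n∸n≡m a c))))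
           (subst (c + p <_) (sym (trans (cong (j +_) (E-end p)) (+-identityʳ j)))
               (subst (_≤ j) (+-suc c p) (unshift-∸ c h))))

    -- Enlarging `j` keeps every threshold, which gives `mono`; `anti` is the row inequality, and
    -- `step` is the column inequality, taking the threshold `suc p` on level `i` to `p` on level
    -- `suc i`.
    isHeight : IsHeight (height g)
    isHeight = record
      { mono  = λ {i} {j} _ _ → ≤-by-< λ p h → let p<a , h′ = height⁻ i j h in height⁺ i (suc j) p<a
          (m≤n⇒m≤1+n h′)
      ; anti  = λ {i} {j} _ _ → ≤-by-< λ p h → let p<a , h′ = height⁻ (suc i) j h in
                  height⁺ i j p<a (≤-trans h′ (+-monoʳ-≤ j (E-row p i)))
      ; step  = λ {i} {j} _ _ → ≤-by-< λ
                  { zero    h → z<s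
                  ; (suc p) h → let p<a , h′ = height⁻ i (suc j) h in
                      s≤s (height⁺ (suc i) j (<-trans (n<1+n p) p<a)
                        (≤-trans (≤-reflexive (sym (+-suc c p)))
                            (s≤s⁻¹ (≤-trans h′ (+-monoʳ-≤ (suc j) (E-column p i)))))) }
      ; start = λ {j} _ → height-start j
      ; end   = height-end
      }

  -- This solves the threshold rule for the entry: on level `a + q ∸ p` and in column
  -- `j = c + p ∸ t`, the condition that `c + p` is less than `j` plus the entry says that `t` is
  -- less than the entry.
  ppᵇ : (ℕ → ℕ → ℕ) → ℕ → ℕ → ℕ → Bool
  ppᵇ N p q t = p <ᵇ N (a + q ∸ p) (c + p ∸ t)

  pp : (ℕ → ℕ → ℕ) → ℕ → ℕ → ℕ
  pp N p q = cnt (ppᵇ N p q) c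

  module HeightToPP {N : ℕ → ℕ → ℕ} (H : IsHeight N) where
    open IsHeight H

    i≤ : ∀ p {q} → q < b → a + q ∸ p ≤ a + b
    i≤ p {q} q<b = ≤-trans (m∸n≤m (a + q) p) (+-monoʳ-≤ a (<⇒≤ q<b))

    j≤ : ∀ {p} t → p < a → c + p ∸ t ≤ a + c
    j≤ {p} t p<a = ≤-trans (m∸n≤m (c + p) t) (≤-trans (+-monoʳ-≤ c (<⇒≤ p<a)) (≤-reflexive (+-comm c a)))

    private
      module DC {p q} (p<a : p < a) (q<b : q < b) = DownClosed (ppᵇ N p q) c
        (λ t _ h → <⇒<ᵇ (≤-trans (<ᵇ⇒< p _ h) (mono* (i≤ p q<b) (∸-monoʳ-≤ (c + p) (n≤1+n t)) (j≤ t p<a))))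

    pp⁺ : ∀ {p q t} → p < a → q < b → t < c → p < N (a + q ∸ p) (c + p ∸ t) → t < pp N p q
    pp⁺ p<a q<b t<c h = DC.cnt⁺ p<a q<b c ≤-refl t<c (<⇒<ᵇ h)

    pp⁻ : ∀ {p q t} → p < a → q < b → t < pp N p q → t < c × p < N (a + q ∸ p) (c + p ∸ t)
    pp⁻ {p} p<a q<b h with DC.cnt⁻ p<a q<b c ≤-refl h
    ... | t<c , h′ = t<c , <ᵇ⇒< p _ h′

    pp-row : ∀ {p q} → p < a → suc q < b → pp N p (suc q) ≤ pp N p q
    pp-row {p} {q} p<a q<b = ≤-by-< λ t h → let t<c , h′ = pp⁻ p<a q<b h in
      pp⁺ p<a (<-trans (n<1+n q) q<b) t<c (≤-trans h′ (≤-trans (≤-reflexive (cong (λ u → N u (c + p ∸ t)) eq))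
        (anti (subst (_≤ a + b) eq (i≤ p q<b)) (j≤ t p<a))))
      where
      eq : a + suc q ∸ p ≡ suc (a + q ∸ p)
      eq = trans (cong (_∸ p) (+-suc a q)) (+-∸-assoc 1 (≤-trans (<⇒≤ p<a) (m≤m+n a q)))

    -- From row `p` to row `suc p` the level drops by one and the column rises by one, which is the
    -- situation of `step`; its extra unit pays for the larger threshold `suc p`. Along a row only
    -- the level changes, so `pp-row` rests on `anti`.
    pp-column : ∀ {p q} → suc p < a → q < b → pp N (suc p) q ≤ pp N p q
    pp-column {p} {q} p<a q<b = ≤-by-< λ t h → let t<c , h′ = pp⁻ p<a q<b h in
      pp⁺ (<-trans (n<1+n p) p<a) q<b t<c (s≤s⁻¹ (≤-trans h′
        (≤-trans (≤-reflexive (cong (N _) (eqj t<c)))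
        (≤-trans (step (subst (_≤ a + b) eqi (i≤ p q<b)) (subst (_≤ a + c) (eqj t<c) (j≤ t p<a)))
                 (≤-reflexive (cong (λ u → suc (N u (c + p ∸ t))) (sym eqi)))))))
      where
      eqi : a + q ∸ p ≡ suc (a + q ∸ suc p)
      eqi = +-∸-assoc 1 (≤-trans (<⇒≤ p<a) (m≤m+n a q))
      eqj : ∀ {t} → t < c → c + suc p ∸ t ≡ suc (c + p ∸ t)
      eqj {t} t<c = trans (cong (_∸ t) (+-suc c p)) (+-∸-assoc 1 (≤-trans (<⇒≤ t<c) (m≤m+n c p)))

    module _ {g : ℕ → ℕ → ℕ} (g≡pp : ∀ {p q} → p < a → q < b → g p q ≡ pp N p q) (π : IsPP g) where
      open PPToHeight π

      -- In the middle zone this is the definition of `pp`; in the left and right zones the boundary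
      -- bounds on `N`, among them `low` and `high`, decide the threshold. The function `g` is
      -- separate from `pp N` because it will be read off a stored array, which agrees with `pp N`
      -- inside the box.
      height≡ : ∀ {i j} → i ≤ a + b → j ≤ a + c → height g i j ≡ N i j
      height≡ {i} {j} hi hj = ≤-antisym (≤-by-< to) (≤-by-< from)
        where
        over : ∀ {p} → c + p < j → p < N i j
        over {p} h = ≤-trans (shift-∸ c (≤-trans (≤-reflexive (+-suc c p)) h)) (∸c≤N hi hj)

        c+p≤ : ∀ {p} → p < a → c + p ≤ a + c
        c+p≤ {p} p<a = lin 1 p<a (solve (p ∷ a ∷ c ∷ []))

        to : ∀ p → p < height g i j → p < N i j
        to p h with height⁻ i j h
        ... | p<a , h′ = go (i + p) refl (zone (i + p)) h′
          where
          go : ∀ u → i + p ≡ u → Zone u → c + p < j + ext g p u → p < N i j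
          go u eq (left u<a) h″ = ≤-trans (low i (suc p)
              (≤-trans (≤-reflexive (trans (+-suc i p) (cong suc eq))) u<a)) (mono* hi p<j hj)
            where
            p<j : p < j
            p<j = +-cancelˡ-≤ c (suc p) j (subst₂ _≤_ (sym (+-suc c p))
                (trans (cong (j +_) (ext-left g p u<a)) (+-comm j c)) h″)
          go _ eq (right q b≤q) h″ = over (subst (c + p <_)
              (trans (cong (j +_) (ext-right g p b≤q)) (+-identityʳ j)) h″)
          go _ eq (mid q q<b) h″ with j ≤? c + p
          ... | no j≰ = over (≰⇒> j≰)
          -- The threshold `t` is the deficit of `j` below `c + p`, so that column `c + p ∸ t` is
          -- `j` itself.
          ... | yes j≤c+p with m≤n⇒∃[o]m+o≡n j≤c+p
          ...   | t , eqt = subst₂ (λ u v → p < N u v) (trans (cong (_∸ p) (sym eq)) (m+n∸n≡m i p))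
              (trans (cong (_∸ t) (sym eqt)) (m+n∸n≡m j t))
                   (proj₂ (pp⁻ p<a q<b t<pp))
            where
            t<pp : t < pp N p q
            t<pp = +-cancelˡ-≤ j (suc t) _ (subst₂ _≤_ (trans (cong suc (sym eqt)) (sym (+-suc j t)))
                (cong (j +_) (trans (ext-mid g p q<b) (g≡pp p<a q<b))) h″)

        from : ∀ p → p < N i j → p < height g i j
        from p h = height⁺ i j p<a (go (i + p) refl (zone (i + p)))
          where
          p<a : p < a
          p<a = ≤-trans h (N≤a hi hj)
          p<j : p < j
          p<j = ≤-trans h (N≤j hi hj)
          go : ∀ u → i + p ≡ u → Zone u → c + p < j + ext g p u
          go u eq (left u<a) = subst₂ _≤_ (+-suc c p)
              (sym (trans (cong (j +_) (ext-left g p u<a)) (+-comm j c))) (+-monoʳ-≤ c p<j)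
          go _ eq (right q b≤q) with j ≤? c + p
          ... | no j≰ = ≤-trans (≰⇒> j≰) (m≤m+n j _)
          ... | yes j≤c+p = ⊥-elim (≤⇒≯ (≤-trans (≤-trans (mono* hi j≤c+p (c+p≤ p<a)) (high hi (c+p≤ p<a) sum≤))
              (≤-reflexive (m+n∸m≡n c p))) h)
            where
            sum≤ : a + b + c ≤ i + (c + p)
            sum≤ = lin 0 (b≤q ⊕ ≤-reflexive (sym eq)) (solve (a ∷ b ∷ c ∷ q ∷ i ∷ p ∷ []))
          go _ eq (mid q q<b) with j ≤? c + p
          ... | no j≰ = ≤-trans (≰⇒> j≰) (m≤m+n j _)
          ... | yes j≤c+p with m≤n⇒∃[o]m+o≡n j≤c+p
          ...   | t , eqt = subst₂ _≤_ (trans (+-suc j t) (cong suc eqt))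
              (cong (j +_) (sym (trans (ext-mid g p q<b) (g≡pp p<a q<b)))) (+-monoʳ-≤ j (pp⁺ p<a q<b t<c
                    (subst₂ (λ u v → p < N u v) (sym (trans (cong (_∸ p) (sym eq)) (m+n∸n≡m i p)))
                        (sym (trans (cong (_∸ t) (sym eqt)) (m+n∸n≡m j t))) h)))
            where
            t<c : t < c
            t<c = lin 0 (≤-reflexive eqt ⊕ p<j) (solve (j ∷ t ∷ c ∷ p ∷ []))

  module _ {g : ℕ → ℕ → ℕ} (π : IsPP g) where
    open PPToHeight π
    open HeightToPP isHeight
    open IsPP π

    -- In column `c + p ∸ t` the threshold rule for row `p` compares `t` with `g p q`; as the entry
    -- is at most `c`, counting `t` up to `c` misses nothing.
    pp-height : ∀ {p q} → p < a → q < b → pp (height g) p q ≡ g p q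
    pp-height {p} {q} p<a q<b = ≤-antisym
      (≤-by-< λ t h → let t<c , h′ = pp⁻ p<a q<b h in
         +-cancelˡ-≤ (c + p ∸ t) (suc t) (g p q) (≤-trans
             (≤-reflexive (trans (+-suc _ t) (cong suc (m∸n+n≡m (t≤ t<c)))))
           (subst (λ u → c + p < c + p ∸ t + u) E≡ (proj₂ (height⁻ (a + q ∸ p) (c + p ∸ t) h′)))))
      (≤-by-< λ t h → let t<c = ≤-trans h (bounded p q<b) in
         pp⁺ p<a q<b t<c (height⁺ (a + q ∸ p) (c + p ∸ t) p<a
           (≤-trans (≤-reflexive (sym (trans (+-suc _ t) (cong suc (m∸n+n≡m (t≤ t<c))))))
             (+-monoʳ-≤ (c + p ∸ t) (subst (suc t ≤_) (sym E≡) h)))))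
      where
      t≤ : ∀ {t} → t < c → t ≤ c + p
      t≤ t<c = ≤-trans (<⇒≤ t<c) (m≤m+n c p)
      E≡ : E p (a + q ∸ p) ≡ g p q
      E≡ = trans (cong (ext g p) (m∸n+n≡m (≤-trans (<⇒≤ p<a) (m≤m+n a q)))) (ext-mid g p q<b)

-- Flows

data Dir : Set where
  X Y Z : Dir

is : Dir → Dir → Bool
is X X = true
is Y Y = true
is Z Z = true
is _ _ = false

T⇒≡true : ∀ {b} → T b → b ≡ true
T⇒≡true {true} _ = refl

¬T⇒≡false : ∀ {b} → ¬ T b → b ≡ false
¬T⇒≡false {true}  h = ⊥-elim (h tt)
¬T⇒≡false {false} _ = refl

cnt-<ᵇ : ∀ a j → cnt (_<ᵇ a) j ≡ j ⊓ a
cnt-<ᵇ a zero = refl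
cnt-<ᵇ a (suc j) with j <? a
... | yes h = trans (cong₂ (λ u v → bit u + v) (T⇒≡true (<⇒<ᵇ h)) (trans (cnt-<ᵇ a j) (m≤n⇒m⊓n≡m (<⇒≤ h))))
    (sym (m≤n⇒m⊓n≡m h))
... | no ¬h = trans (cong₂ (λ u v → bit u + v) (¬T⇒≡false (¬h ∘ <ᵇ⇒< j a))
    (trans (cnt-<ᵇ a j) (m≥n⇒m⊓n≡n (≮⇒≥ ¬h))))
                    (sym (m≥n⇒m⊓n≡n (m≤n⇒m≤1+n (≮⇒≥ ¬h))))

cnt-≤ᵇ : ∀ c j → cnt (c ≤ᵇ_) j ≡ j ∸ c
cnt-≤ᵇ c zero = sym (0∸n≡0 c)
cnt-≤ᵇ c (suc j) with c ≤? j
... | yes h = trans (cong₂ (λ u v → bit u + v) (T⇒≡true (≤⇒≤ᵇ h)) (cnt-≤ᵇ c j)) (sym (+-∸-assoc 1 h))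
... | no ¬h = trans (cong₂ (λ u v → bit u + v) (¬T⇒≡false (¬h ∘ ≤ᵇ⇒≤ c j))
    (trans (cnt-≤ᵇ c j) (m≤n⇒m∸n≡0 (<⇒≤ (≰⇒> ¬h)))))
                    (sym (m≤n⇒m∸n≡0 (≰⇒> ¬h)))

module Flows (a b c : ℕ) (0<a : 0 < a) where
  open Heights a b c public

  -- Nothing precedes level 0, so its first `a` points are declared to be entered from outside; this
  -- produces the starting height `j ⊓ a`.
  enters : (ℕ → ℕ → Dir) → ℕ → ℕ → Bool
  enters d zero    j = j <ᵇ a
  enters d (suc i) j = is X (d i j)

  prevY : (ℕ → ℕ → Dir) → ℕ → ℕ → Bool
  prevY d i zero    = false
  prevY d i (suc j) = is Y (d i j)

  flux : (ℕ → ℕ → Dir) → ℕ → ℕ → ℕ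
  flux d i j = cnt (enters d i) j

  -- A z-move keeps `(i , j)`. A monomial of degree `m + 1` over `(i , j)` can thus be reached by X
  -- from the level before, by Y from the column before, or by Z from `(i , j)` itself, and
  -- `conserve` asks for exactly one of these. `exit` prescribes the x-edges that leave the last
  -- level, and with them the final height `j ∸ c`.
  record IsFlow (d : ℕ → ℕ → Dir) : Set where
    field
      conserve : ∀ i j → i < a + b → j < a + c →
                 bit (enters d i j) + (bit (prevY d i j) + bit (is Z (d i j))) ≡ 1
      exit     : ∀ i j → suc i ≡ a + b → j < a + c → is X (d i j) ≡ (c ≤ᵇ j)

    -- Conservation telescopes along the columns: whatever enters left of column `j` also leaves by
    -- an x-edge left of `j`, except for the path that a y-edge may be carrying into column `j`.
    level : ∀ {i} → i < a + b → ∀ j → j ≤ a + c → flux d i j ≡ bit (prevY d i j) + flux d (suc i) j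
    level i< zero    _  = refl
    level {i} i< (suc j) j< = trans (cong (bit (enters d i j) +_) (level i< j (<⇒≤ j<)))
      (exchange (d i j) (enters d i j) (prevY d i j) (conserve i j i< j<))
      where
      exchange : ∀ D e y {n} → bit e + (bit y + bit (is Z D)) ≡ 1 →
                 bit e + (bit y + n) ≡ bit (is Y D) + (bit (is X D) + n)
      exchange X true  false _ = refl
      exchange X false true  _ = refl
      exchange Y true  false _ = refl
      exchange Y false true  _ = refl
      exchange Z false false _ = refl
      exchange X true  true  ()
      exchange X false false ()
      exchange Y true  true  ()
      exchange Y false false ()
      exchange Z true  true  ()
      exchange Z true  false ()
      exchange Z false true  ()

    isHeight : IsHeight (flux d)
    isHeight = record
      { mono  = λ {i} {j} _ _ → m≤n+m (flux d i j) (bit (enters d i j))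
      ; anti  = λ {i} {j} i< j≤ → ≤-trans (m≤n+m _ (bit (prevY d i j))) (≤-reflexive (sym (level i< j j≤)))
      ; step  = λ {i} {j} i< j< → ≤-trans (≤-reflexive (level i< (suc j) j<)) (XY≤1 (d i j))
      ; start = λ {j} _ → cnt-<ᵇ a j
      ; end   = λ {j} j≤ → trans (cnt-cong j λ x x<j → last x (≤-trans x<j j≤) (a + b) refl
          (≤-trans 0<a (m≤m+n a b))) (cnt-≤ᵇ c j)
      }
      where
      XY≤1 : ∀ D {n} → bit (is Y D) + (bit (is X D) + n) ≤ suc n
      XY≤1 X = ≤-refl
      XY≤1 Y = ≤-refl
      XY≤1 Z = n≤1+n _
      last : ∀ j → j < a + c → ∀ n → n ≡ a + b → 0 < n → enters d n j ≡ (c ≤ᵇ j)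
      last j j< (suc i) eq _ = exit i j eq j<

  flux-cong : ∀ {d d′} → (∀ {i j} → i < a + b → j < a + c → d i j ≡ d′ i j) →
              ∀ {i j} → i ≤ a + b → j ≤ a + c → flux d i j ≡ flux d′ i j
  flux-cong h {zero}  i≤ j≤ = refl
  flux-cong h {suc i} {j} i< j≤ = cnt-cong j λ x x<j → cong (is X) (h i< (≤-trans x<j j≤))

  -- For heights with `n₀ ≤ n₁ ≤ n₂ ≤ suc n₀` at most one of the two increments is positive: X names
  -- the first, Y the second, and Z stands for neither. Storing only comparisons makes `dir` total
  -- on arbitrary functions.
  data Classified (n₀ n₁ n₂ : ℕ) : Dir → Set where
    isX : n₀ < n₁ → Classified n₀ n₁ n₂ X
    isY : n₁ ≤ n₀ → n₁ < n₂ → Classified n₀ n₁ n₂ Y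
    isZ : n₁ ≤ n₀ → n₂ ≤ n₁ → Classified n₀ n₁ n₂ Z

  classify : ∀ n₀ n₁ n₂ → ∃ (Classified n₀ n₁ n₂)
  classify n₀ n₁ n₂ with n₀ <? n₁ | n₁ <? n₂
  ... | yes h | _      = X , isX h
  ... | no h  | yes h′ = Y , isY (≮⇒≥ h) h′
  ... | no h  | no h′  = Z , isZ (≮⇒≥ h) (≮⇒≥ h′)

  classified-bits : ∀ D {D′ n n₁ n₂} → Classified n n₁ n₂ D′ →
                    n₁ ≡ bit (is X D) + n → n₂ ≡ bit (is Y D) + n₁ → D′ ≡ D
  classified-bits X (isX h)   refl refl = refl
  classified-bits Y (isY _ h) refl refl = refl
  classified-bits Z (isZ _ h) refl refl = refl
  classified-bits Y (isX h)   refl refl = ⊥-elim (n≮n _ h)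
  classified-bits Z (isX h)   refl refl = ⊥-elim (n≮n _ h)
  classified-bits X (isY h _) refl refl = ⊥-elim (n≮n _ h)
  classified-bits Z (isY _ h) refl refl = ⊥-elim (n≮n _ h)
  classified-bits X (isZ h _) refl refl = ⊥-elim (n≮n _ h)
  classified-bits Y (isZ _ h) refl refl = ⊥-elim (n≮n _ h)

  dir : (ℕ → ℕ → ℕ) → ℕ → ℕ → Dir
  dir N i j = proj₁ (classify (N (suc i) j) (N (suc i) (suc j)) (N i (suc j)))

  dir-classified : ∀ N i j → Classified (N (suc i) j) (N (suc i) (suc j)) (N i (suc j)) (dir N i j)
  dir-classified N i j = proj₂ (classify (N (suc i) j) (N (suc i) (suc j)) (N i (suc j)))

  -- By `level` the two increments of the flux at `(i , j)` are the X bit and the Y bit of the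
  -- direction there. Allowing any `N` that agrees with the flux lets two matchings with equal
  -- heights be compared.
  dir-flux : ∀ {d} → IsFlow d → ∀ {N} → (∀ {i j} → i ≤ a + b → j ≤ a + c → N i j ≡ flux d i j) →
             ∀ {i j} → i < a + b → j < a + c → dir N i j ≡ d i j
  dir-flux {d} F {N} N≡ {i} {j} i< j< = classified-bits (d i j) (dir-classified N i j)
    (trans (N≡ i< j<) (cong (bit (is X (d i j)) +_) (sym (N≡ i< (<⇒≤ j<)))))
    (trans (N≡ (<⇒≤ i<) j<) (trans (IsFlow.level F i< (suc j) j<)
        (cong (bit (is Y (d i j)) +_) (sym (N≡ i< j<)))))

  -- Induction on the column: `anti` and `step` bound the increment of `N` along a level by one, so
  -- the X bit is the whole increment.
  flux-dir : ∀ {N} → IsHeight N → ∀ {i j} → i ≤ a + b → j ≤ a + c → flux (dir N) i j ≡ N i j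
  flux-dir {N} H {zero}  {j} i≤ j≤ = trans (cnt-<ᵇ a j) (sym (IsHeight.start H j≤))
  flux-dir {N} H {suc i} {zero} i< j≤ = sym (n≤0⇒n≡0 (IsHeight.N≤j H i< z≤n))
  flux-dir {N} H {suc i} {suc j} i< j< = trans (cong (bit (is X (dir N i j)) +_) (flux-dir H i< (<⇒≤ j<)))
    (go (dir-classified N i j))
    where
    open IsHeight H
    go : ∀ {D} → Classified (N (suc i) j) (N (suc i) (suc j)) (N i (suc j)) D → bit (is X D) + N (suc i) j ≡ N
        (suc i) (suc j)
    go (isX h)   = ≤-antisym h (≤-trans (anti i< j<) (step i< j<))
    go (isY h _) = ≤-antisym (mono i< j<) h
    go (isZ h _) = ≤-antisym (mono i< j<) h

-- The monomial bases

module _ {A : Set} where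

  AllPairs-lookup : ∀ {R : A → A → Set} {xs} → AllPairs R xs → ∀ {r s} → r Fin.< s →
      R (List.lookup xs r) (List.lookup xs s)
  AllPairs-lookup (px ∷ _) {Fin.zero}  {Fin.suc s} _       = All.lookup px (∈-lookup s)
  AllPairs-lookup (_ ∷ ps) {Fin.suc r} {Fin.suc s} (s≤s h) = AllPairs-lookup ps h

  lookup-injective : ∀ {xs : List A} → Unique xs → ∀ {r s} → List.lookup xs r ≡ List.lookup xs s → r ≡ s
  lookup-injective u {r} {s} eq with Finₚ.<-cmp r s
  ... | tri< h _ _ = ⊥-elim (AllPairs-lookup u h eq)
  ... | tri≈ _ h _ = h
  ... | tri> _ _ h = ⊥-elim (AllPairs-lookup u h (sym eq))

  length-≤ : {B : Set} {xs : List A} {ys : List B} → Unique xs → (f : ∀ {x} → x ∈ xs → B) →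
             (∀ {x} (p : x ∈ xs) → f p ∈ ys) → (∀ {x y} (p : x ∈ xs) (q : y ∈ xs) → f p ≡ f q → x ≡ y) →
             length xs ≤ length ys
  length-≤ {ys = ys} u f f∈ f-inj = injective⇒≤ {f = λ r → index (f∈ (∈-lookup r))} λ {r} {s} eq →
    lookup-injective u (f-inj (∈-lookup r) (∈-lookup s)
      (trans (lookup-index (f∈ (∈-lookup r))) (trans (cong (List.lookup ys) eq)
          (sym (lookup-index (f∈ (∈-lookup s)))))))

  index-lookup : ∀ {xs : List A} → Unique xs → ∀ {x} (p : x ∈ xs) {r} → List.lookup xs r ≡ x → r ≡ index p
  index-lookup u p eq = lookup-injective u (trans eq (lookup-index p))

  concatMap-sorted : ∀ {R : A → A → Set} {f : ℕ → List A} n → (∀ i → AllPairs R (f i)) →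
    (∀ {i i′ x y} → i < i′ → x ∈ f i → y ∈ f i′ → R x y) → AllPairs R (concatMap f (upTo n))
  concatMap-sorted n each cross = AllPairsₚ.concat⁺ (Allₚ.map⁺ (All.tabulate λ {i} _ → each i))
    (AllPairsₚ.map⁺ (AllPairsₚ.applyUpTo⁺₁ (λ i → i) n λ i<j _ → All.tabulate λ x∈ → All.tabulate λ y∈ →
        cross i<j x∈ y∈))

  index-++⁺ˡ : ∀ {xs ys : List A} {x} (p : x ∈ xs) → toℕ (index (∈-++⁺ˡ {ys = ys} p)) ≡ toℕ (index p)
  index-++⁺ˡ (here _)  = refl
  index-++⁺ˡ (there p) = cong suc (index-++⁺ˡ p)

  index-++⁺ʳ : ∀ xs {ys : List A} {x} (p : x ∈ ys) → toℕ (index (∈-++⁺ʳ xs p)) ≡ length xs + toℕ (index p)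
  index-++⁺ʳ []       p = refl
  index-++⁺ʳ (x ∷ xs) p = cong suc (index-++⁺ʳ xs p)

  index-map⁺ : ∀ {B : Set} (f : A → B) {xs} {x} (p : x ∈ xs) → toℕ (index (∈-map⁺ f p)) ≡ toℕ (index p)
  index-map⁺ f (here _)  = refl
  index-map⁺ f (there p) = cong suc (index-map⁺ f p)

  -- An element of `us` lies in the prefix of `xs` and its image in the suffix of `ys` behind `ws`.
  -- For multiplication by x this makes the displacement of every x-edge the same.
  index-shift : ∀ (f : A → A) {xs ys} us vs ws → xs ≡ us ++ vs → ys ≡ ws ++ map f us → Unique xs → Unique ys →
    ∀ {x} → x ∈ us → ∀ {r s} → List.lookup xs r ≡ x → List.lookup ys s ≡ f x → toℕ s ≡ length ws + toℕ r
  index-shift f us vs ws refl refl u u′ p {r} {s} er es =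
    trans (cong toℕ (index-lookup u′ (∈-++⁺ʳ ws (∈-map⁺ f p)) es))
    (trans (index-++⁺ʳ ws (∈-map⁺ f p))
    (cong (length ws +_) (trans (index-map⁺ f p) (sym
        (trans (cong toℕ (index-lookup u (∈-++⁺ˡ p) er)) (index-++⁺ˡ p))))))

infix 4 _≺_
_≺_ : Monomial → Monomial → Set
(i , j , k) ≺ (i′ , j′ , k′) = i < i′ ⊎ (i ≡ i′ × (j < j′ ⊎ (j ≡ j′ × k < k′)))

≺⇒≢ : ∀ {μ ν} → μ ≺ ν → μ ≢ ν
≺⇒≢ (inj₁ h)                     refl = n≮n _ h
≺⇒≢ (inj₂ (_ , inj₁ h))       refl = n≮n _ h
≺⇒≢ (inj₂ (_ , inj₂ (_ , h))) refl = n≮n _ h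

shiftX : Monomial → Monomial
shiftX (i , j , k) = suc i , j , k

module Slabs (B C d : ℕ) where

  fibre : ℕ → ℕ → List Monomial
  fibre i j = map (λ k → (i , j , k)) (filterᵇ (λ k → (i + j + k) ≡ᵇ d) (upTo C))

  slice : ℕ → List Monomial
  slice i = concatMap (fibre i) (upTo B)

  -- For `B = a + c` and `C = b + c`, `slab (a + b)` is `basis a b c d` by definition; a smaller
  -- argument keeps only the first levels.
  slab : ℕ → List Monomial
  slab n = concatMap slice (upTo n)

  ∈-fibre⁺ : ∀ {i j k} → k < C → i + j + k ≡ d → (i , j , k) ∈ fibre i j
  ∈-fibre⁺ {i} {j} k< eq = ∈-map⁺ _ (∈-filter⁺ (λ k → T? (i + j + k ≡ᵇ d)) (∈-upTo⁺ k<) (≡⇒≡ᵇ _ d eq))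

  ∈-fibre⁻ : ∀ {i j μ} → μ ∈ fibre i j → ∃ λ k → μ ≡ (i , j , k) × k < C × i + j + k ≡ d
  ∈-fibre⁻ {i} {j} p with ∈-map⁻ _ p
  ... | k , q , eq with ∈-filter⁻ (λ k → T? (i + j + k ≡ᵇ d)) q
  ...   | q′ , h = k , eq , ∈-upTo⁻ q′ , ≡ᵇ⇒≡ _ d h

  ∈-slice⁺ : ∀ {i j k} → j < B → k < C → i + j + k ≡ d → (i , j , k) ∈ slice i
  ∈-slice⁺ j< k< eq = ∈-concatMap⁺ (fibre _) (lose (∈-upTo⁺ j<) (∈-fibre⁺ k< eq))

  ∈-slice⁻ : ∀ {i μ} → μ ∈ slice i → ∃₂ λ j k → μ ≡ (i , j , k) × j < B × k < C × i + j + k ≡ d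
  ∈-slice⁻ p with find (∈-concatMap⁻ (fibre _) {xs = upTo B} p)
  ... | j , j∈ , q with ∈-fibre⁻ q
  ...   | k , eq , k< , sum = j , k , eq , ∈-upTo⁻ j∈ , k< , sum

  ∈-slab⁺ : ∀ n {i j k} → i < n → j < B → k < C → i + j + k ≡ d → (i , j , k) ∈ slab n
  ∈-slab⁺ n i< j< k< eq = ∈-concatMap⁺ slice (lose (∈-upTo⁺ i<) (∈-slice⁺ j< k< eq))

  ∈-slab⁻ : ∀ n {i j k} → (i , j , k) ∈ slab n → i < n × j < B × k < C × i + j + k ≡ d
  ∈-slab⁻ n p with find (∈-concatMap⁻ slice {xs = upTo n} p)
  ... | i , i∈ , q with ∈-slice⁻ q
  ...   | j , k , refl , j< , k< , sum = ∈-upTo⁻ i∈ , j< , k< , sum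

  fibre-sorted : ∀ i j → AllPairs _≺_ (fibre i j)
  fibre-sorted i j = AllPairsₚ.map⁺ (AllPairsₚ.filter⁺ (λ k → T? (i + j + k ≡ᵇ d))
    (AllPairsₚ.applyUpTo⁺₁ (λ k → k) C λ k<k′ _ → inj₂ (refl , inj₂ (refl , k<k′))))

  slice-sorted : ∀ i → AllPairs _≺_ (slice i)
  slice-sorted i = concatMap-sorted B (fibre-sorted i) cross
    where
    cross : ∀ {j j′ μ ν} → j < j′ → μ ∈ fibre i j → ν ∈ fibre i j′ → μ ≺ ν
    cross j<j′ p q with ∈-fibre⁻ p | ∈-fibre⁻ q
    ... | _ , refl , _ | _ , refl , _ = inj₂ (refl , inj₁ j<j′)

  slab-sorted : ∀ n → AllPairs _≺_ (slab n)
  slab-sorted n = concatMap-sorted n slice-sorted cross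
    where
    cross : ∀ {i i′ μ ν} → i < i′ → μ ∈ slice i → ν ∈ slice i′ → μ ≺ ν
    cross i<i′ p q with ∈-slice⁻ p | ∈-slice⁻ q
    ... | _ , _ , refl , _ | _ , _ , refl , _ = inj₁ i<i′

  slab-unique : ∀ n → Unique (slab n)
  slab-unique n = AllPairs.map ≺⇒≢ (slab-sorted n)

  slab-suc : ∀ n → slab (suc n) ≡ slab n ++ (slice n ++ [])
  slab-suc n = trans (cong (concatMap slice) (sym (upTo-∷ʳ n))) (concatMap-++ slice (upTo n) [ n ])

-- The degree tests on the two sides differ by a successor on each side of `≡ᵇ` and reduce to the
-- same test on `k`.
slice-shift : ∀ B C d i → Slabs.slice B C (suc d) (suc i) ≡ map shiftX (Slabs.slice B C d i)
slice-shift B C d i = sym (trans (map-concatMap shiftX (Slabs.fibre B C d i) (upTo B))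
  (concatMap-cong (λ j → sym (map-∘ (filterᵇ (λ k → i + j + k ≡ᵇ d) (upTo C)))) (upTo B)))

slab-shift : ∀ B C d n → Slabs.slab B C (suc d) (suc n) ≡ Slabs.slice B C (suc d) 0 ++ map shiftX
    (Slabs.slab B C d n)
slab-shift B C d n = cong (Slabs.slice B C (suc d) 0 ++_)
  (trans (cong (concatMap (Slabs.slice B C (suc d))) (sym (map-upTo suc n)))
  (trans (concatMap-map (Slabs.slice B C (suc d)) suc (upTo n))
  (trans (concatMap-cong (slice-shift B C d) (upTo n))
      (sym (map-concatMap shiftX (Slabs.slice B C d) (upTo n))))))

-- Complementary monomials

module Dual (A B C : ℕ) where

  flip : ℕ → ℕ → ℕ
  flip n i = n ∸ suc i

  +-flip : ∀ {n i} → i < n → i + suc (flip n i) ≡ n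
  +-flip {n} {i} h = trans (+-suc i (flip n i)) (m+[n∸m]≡n h)

  flip-< : ∀ {n i} → i < n → flip n i < n
  flip-< {n} {i} h = subst (flip n i <_) (+-flip h) (m≤n+m (suc (flip n i)) i)

  flip-injective : ∀ {n i j} → i < n → j < n → flip n i ≡ flip n j → i ≡ j
  flip-injective h h′ eq = suc-injective (∸-cancelˡ-≡ h h′ eq)

  -- The complement in the socle monomial, whose exponents are `A ∸ 1`, `B ∸ 1` and `C ∸ 1`. The
  -- degrees `m` and `m + 1` add up to the degree of that monomial, so complementation injects each
  -- of the two bases into the other and the matrix is square.
  dual : Monomial → Monomial
  dual (i , j , k) = flip A i , flip B j , flip C k

  module _ {d d′ : ℕ} (sum : d + d′ + 3 ≡ A + B + C) where

    dual-∈ : ∀ {μ} → μ ∈ Slabs.slab B C d A → dual μ ∈ Slabs.slab B C d′ A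
    dual-∈ {i , j , k} p = complement (Slabs.∈-slab⁻ B C d A p)
      where
      sum-identity : ∀ i j k i′ j′ k′ → i + j + k + 3 + (i′ + j′ + k′) ≡ (i + suc i′) + (j + suc j′) +
          (k + suc k′)
      sum-identity i j k i′ j′ k′ = solve (i ∷ j ∷ k ∷ i′ ∷ j′ ∷ k′ ∷ [])
      swap : d + 3 + d′ ≡ d + d′ + 3
      swap = solve (d ∷ d′ ∷ [])
      complement : i < A × j < B × k < C × i + j + k ≡ d → dual (i , j , k) ∈ Slabs.slab B C d′ A
      complement (i< , j< , k< , eq) = Slabs.∈-slab⁺ B C d′ A (flip-< i<) (flip-< j<) (flip-< k<)
        (+-cancelˡ-≡ (i + j + k + 3) (flip A i + flip B j + flip C k) d′
          (trans (sum-identity i j k _ _ _) (trans (cong₂ _+_ (cong₂ _+_ (+-flip i<) (+-flip j<)) (+-flip k<))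
                 (sym (trans (trans (cong (λ u → u + 3 + d′) eq) swap) sum)))))

    dual-injective : ∀ {μ ν} → μ ∈ Slabs.slab B C d A → ν ∈ Slabs.slab B C d A → dual μ ≡ dual ν → μ ≡ ν
    dual-injective {i , j , k} {i′ , j′ , k′} p q = go (Slabs.∈-slab⁻ B C d A p) (Slabs.∈-slab⁻ B C d A q)
      where
      go : i < A × j < B × k < C × i + j + k ≡ d → i′ < A × j′ < B × k′ < C × i′ + j′ + k′ ≡ d →
           dual (i , j , k) ≡ dual (i′ , j′ , k′) → (i , j , k) ≡ (i′ , j′ , k′)
      go (i< , j< , k< , _) (i<′ , j<′ , k<′ , _) eq =
        cong₂ _,_ (flip-injective i< i<′ (cong proj₁ eq))
            (cong₂ _,_ (flip-injective j< j<′ (cong (proj₁ ∘ proj₂) eq))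
              (flip-injective k< k<′ (cong (proj₂ ∘ proj₂) eq)))

    dual-≤ : length (Slabs.slab B C d A) ≤ length (Slabs.slab B C d′ A)
    dual-≤ = length-≤ (Slabs.slab-unique B C d A) (λ {μ} _ → dual μ) dual-∈ dual-injective

socle-degree : ∀ m a b c → 2 + m ≡ a + b + c → m + suc m + 3 ≡ (a + b) + (a + c) + (b + c)
socle-degree m a b c h = trans (rearrange m) (trans (cong₂ _+_ h h) (double a b c))
  where
  rearrange : ∀ m → m + suc m + 3 ≡ (2 + m) + (2 + m)
  rearrange m = solve (m ∷ [])
  double : ∀ a b c → (a + b + c) + (a + b + c) ≡ (a + b) + (a + c) + (b + c)
  double a b c = solve (a ∷ b ∷ c ∷ [])

-- Matchings

lin-⊥ : ∀ s {x y} → x ≤ y → x ≡ y + suc s → ⊥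
lin-⊥ s {x} {y} h e = m+1+n≰m y (≤-trans (≤-reflexive (sym e)) h)

injective⇒surjective : ∀ {n n′} → n ≡ n′ → {f : Fin n → Fin n′} → (∀ {r s} → f r ≡ f s → r ≡ s) → ∀ s → ∃ λ r →
    f r ≡ s
injective⇒surjective {suc n} refl {f} inj s with any? (λ r → f r Finₚ.≟ s)
... | yes p = p
... | no ¬p = ⊥-elim (n≮n n (injective⇒≤ {f = λ r → punchOut (missed r)} λ {r} {t} eq →
    inj (punchOut-injective (missed r) (missed t) eq)))
  where
  missed : ∀ r → s ≢ f r
  missed r eq = ¬p (r , sym eq)

move : Dir → Monomial → Monomial
move X (i , j , k) = suc i , j , k
move Y (i , j , k) = i , suc j , k
move Z (i , j , k) = i , j , suc k

move-injective : ∀ D {μ ν} → move D μ ≡ move D ν → μ ≡ ν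
move-injective X refl = refl
move-injective Y refl = refl
move-injective Z refl = refl

move-dir : ∀ {D D′} μ → move D μ ≡ move D′ μ → D ≡ D′
move-dir {X} {X} _ _ = refl
move-dir {Y} {Y} _ _ = refl
move-dir {Z} {Z} _ _ = refl
move-dir {X} {Y} _ ()
move-dir {X} {Z} _ ()
move-dir {Y} {X} _ ()
move-dir {Y} {Z} _ ()
move-dir {Z} {X} _ ()
move-dir {Z} {Y} _ ()

is-refl : ∀ D → is D D ≡ true
is-refl X = refl
is-refl Y = refl
is-refl Z = refl

is-sound : ∀ D D′ → is D D′ ≡ true → D′ ≡ D
is-sound X X _ = refl
is-sound Y Y _ = refl
is-sound Z Z _ = refl

is-cong : ∀ {D D₁ D₂} → (D₁ ≡ D → D₂ ≡ D) → (D₂ ≡ D → D₁ ≡ D) → is D D₁ ≡ is D D₂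
is-cong {D} {D₁} {D₂} f g with is D D₁ in e₁ | is D D₂ in e₂
... | true  | true  = refl
... | false | false = refl
... | true  | false with () ← trans (sym e₂) (trans (cong (is D) (f (is-sound D D₁ e₁))) (is-refl D))
... | false | true  with () ← trans (sym e₁) (trans (cong (is D) (g (is-sound D D₂ e₂))) (is-refl D))

noX : ∀ D μ {j k} → (0 , j , k) ≡ move D μ → is X D ≡ false
noX X μ ()
noX Y μ _ = refl
noX Z μ _ = refl

noY : ∀ D μ {i k} → (i , 0 , k) ≡ move D μ → is Y D ≡ false
noY X μ _ = refl
noY Y μ ()
noY Z μ _ = refl

noZ : ∀ D μ {i j} → (i , j , 0) ≡ move D μ → is Z D ≡ false
noZ X μ _ = refl
noZ Y μ _ = refl
noZ Z μ ()

module Matchings (a b c m : ℕ) (0<a : 0 < a) (m+2 : 2 + m ≡ a + b + c)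
  (L H : List Monomial) (L! : Unique L) (H! : Unique H) (sameLength : length L ≡ length H)
  (L⁺ : ∀ {i j k} → i < a + b → j < a + c → k < b + c → i + j + k ≡ m → (i , j , k) ∈ L)
  (L⁻ : ∀ {i j k} → (i , j , k) ∈ L → i < a + b × j < a + c × k < b + c × i + j + k ≡ m)
  (H⁺ : ∀ {i j k} → i < a + b → j < a + c → k < b + c → i + j + k ≡ suc m → (i , j , k) ∈ H)
  (H⁻ : ∀ {i j k} → (i , j , k) ∈ H → i < a + b × j < a + c × k < b + c × i + j + k ≡ suc m)
  where

  open Flows a b c 0<a public

  _≟ᴹ_ : DecidableEquality Monomial
  _≟ᴹ_ = ≡-dec _≟_ (≡-dec _≟_ _≟_)

  open DecMembership _≟ᴹ_ using (_∈?_)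

  record IsMatching (f : Fin (length L) → Fin (length H)) : Set where
    field
      injective : ∀ {r s} → f r ≡ f s → r ≡ s
      adjacent  : ∀ r → Σ Dir λ D → List.lookup H (f r) ≡ move D (List.lookup L r)

    way : Fin (length L) → Dir
    way r = proj₁ (adjacent r)

    -- When m < i + j the truncated difference is 0, and (i , j , 0) has the wrong degree to lie in L.
    grid : ℕ → ℕ → Dir
    grid i j with (i , j , m ∸ (i + j)) ∈? L
    ... | yes p = way (index p)
    ... | no _  = X

    grid-in : ∀ {i j k} r → List.lookup L r ≡ (i , j , k) → grid i j ≡ way r
    grid-in {i} {j} {k} r eq with L⁻ (subst (_∈ L) eq (∈-lookup r))
    ... | _ , _ , _ , sum with (i , j , m ∸ (i + j)) ∈? L
    ...   | yes p = cong way (sym (index-lookup L! p (trans eq k≡)))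
      where
      k≡ : (i , j , k) ≡ (i , j , m ∸ (i + j))
      k≡ = cong (λ u → i , j , u) (sym (trans (cong (_∸ (i + j)) (sym sum)) (m+n∸m≡n (i + j) k)))
    ...   | no ¬p = ⊥-elim (¬p (subst (_∈ L) (trans eq k≡) (∈-lookup r)))
      where
      k≡ : (i , j , k) ≡ (i , j , m ∸ (i + j))
      k≡ = cong (λ u → i , j , u) (sym (trans (cong (_∸ (i + j)) (sym sum)) (m+n∸m≡n (i + j) k)))

    grid-∈ : ∀ {i j k} (p : (i , j , k) ∈ L) → grid i j ≡ way (index p)
    grid-∈ p = grid-in (index p) (sym (lookup-index p))

    grid-out : ∀ {i j} → (∀ k → (i , j , k) ∉ L) → grid i j ≡ X
    grid-out {i} {j} h with (i , j , m ∸ (i + j)) ∈? L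
    ... | yes p = ⊥-elim (h _ p)
    ... | no _  = refl

    -- If both directions are `D`, then `r` and `r′` coincide: injectivity of `f` yields this when
    -- `r′` moves by `D`, and injectivity of the move when `r` does.
    same : ∀ D r r′ → move D (List.lookup L r′) ≡ List.lookup H (f r) → is D (way r′) ≡ is D (way r)
    same D r r′ eq = is-cong
      (λ w → trans (cong way (sym (injective (lookup-injective H!
          (trans (proj₂ (adjacent r′)) (trans (cong (λ u → move u _) w) eq)))))) w)
      (λ w → trans (cong way (lookup-injective L! (move-injective D
          (trans eq (trans (proj₂ (adjacent r)) (cong (λ u → move u _) w)))))) w)

    tooLow : ∀ {i j} → 2 + (i + j) ≤ a → ∀ k → (i , j , k) ∉ L
    tooLow {i} {j} h k p with L⁻ p
    ... | _ , _ , k< , sum = lin-⊥ 0 (h ⊕ k< ⊕ ≤-reflexive (sym sum) ⊕ ≤-reflexive (sym m+2))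
        (solve (i ∷ j ∷ k ∷ m ∷ a ∷ b ∷ c ∷ []))

    tooHigh : ∀ {i j} → a + b + c ≤ suc (i + j) → ∀ k → (i , j , k) ∉ L
    tooHigh {i} {j} h k p with L⁻ p
    ... | _ , _ , _ , sum = lin-⊥ k (h ⊕ ≤-reflexive sum ⊕ ≤-reflexive m+2)
        (solve (i ∷ j ∷ k ∷ m ∷ a ∷ b ∷ c ∷ []))

    target : ∀ {i j k D} (p : (i , j , k) ∈ L) → way (index p) ≡ D → move D (i , j , k) ∈ H
    target p w = subst (_∈ H) (trans (proj₂ (adjacent (index p))) (cong₂ move w (sym (lookup-index p))))
        (∈-lookup (f (index p)))

    isFlow : IsFlow grid
    isFlow = record { conserve = conserve ; exit = exit }
      where
      one : ∀ D → bit (is X D) + (bit (is Y D) + bit (is Z D)) ≡ 1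
      one X = refl
      one Y = refl
      one Z = refl

      bits : ∀ {x y z x′ y′ z′} → x ≡ x′ → y ≡ y′ → z ≡ z′ → bit x′ + (bit y′ + bit z′) ≡ 1 →
          bit x + (bit y + bit z) ≡ 1
      bits refl refl refl h = h

      -- Predecessors lie outside the hexagon and move by X, so the point is entered from the level
      -- before, or from outside on level 0. On the line `suc (i + j) = a` the point itself is in
      -- `L`, but with `k` maximal, so its z-move vanishes in the ring.
      conserve-low : ∀ i j → i < a + b → j < a + c → i + j < a →
                     bit (enters grid i j) + (bit (prevY grid i j) + bit (is Z (grid i j))) ≡ 1
      conserve-low i j i< j< lo = bits (enters≡ i lo) (prevY≡ j lo) notZ refl
        where
        enters≡ : ∀ i → i + j < a → enters grid i j ≡ true
        enters≡ zero    h = T⇒≡true (<⇒<ᵇ h)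
        enters≡ (suc i) h = cong (is X) (grid-out (tooLow h))
        prevY≡ : ∀ j → i + j < a → prevY grid i j ≡ false
        prevY≡ zero    h = refl
        prevY≡ (suc j) h = cong (is Y) (grid-out (tooLow (subst (_≤ a) (cong suc (+-suc i j)) h)))
        notZ : is Z (grid i j) ≡ false
        notZ with (i , j , m ∸ (i + j)) ∈? L
        ... | no _ = refl
        ... | yes p with way (index p) in w
        ...   | X = refl
        ...   | Y = refl
        ...   | Z with L⁻ p | H⁻ (target p w)
        ...     | _ , _ , _ , sum | _ , _ , k< , _ =
          ⊥-elim (contra (m ∸ (i + j)) sum k<)
          where
          contra : ∀ k → i + j + k ≡ m → suc k < b + c → ⊥
          contra k sum k< = lin-⊥ 0 (lo ⊕ k< ⊕ ≤-reflexive (sym sum) ⊕ ≤-reflexive (sym m+2))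
              (solve (i ∷ j ∷ k ∷ m ∷ a ∷ b ∷ c ∷ []))

      -- The point and its predecessors have `i + j` above `m`, hence all move by X; the bound on
      -- `j` excludes level 0.
      conserve-high : ∀ i j → i < a + b → j < a + c → a + b + c ≤ i + j →
                      bit (enters grid i j) + (bit (prevY grid i j) + bit (is Z (grid i j))) ≡ 1
      conserve-high i j i< j< hi = bits (enters≡ i hi) (prevY≡ j hi)
          (cong (is Z) (grid-out (tooHigh (m≤n⇒m≤1+n hi)))) refl
        where
        enters≡ : ∀ i → a + b + c ≤ i + j → enters grid i j ≡ true
        enters≡ zero    h = ⊥-elim (lin-⊥ b (h ⊕ j<) (solve (j ∷ a ∷ b ∷ c ∷ [])))
        enters≡ (suc i) h = cong (is X) (grid-out (tooHigh h))
        prevY≡ : ∀ j → a + b + c ≤ i + j → prevY grid i j ≡ false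
        prevY≡ zero    h = refl
        prevY≡ (suc j) h = cong (is Y) (grid-out (tooHigh (subst (a + b + c ≤_) (+-suc i j) h)))

      -- Here `(i , j , k)` is a basis monomial of degree `m + 1`. An injective matching between
      -- bases of equal size hits it from some `r`, and by `same` the three bits are those of the
      -- direction of `r`.
      conserve-mid : ∀ i j k → i < a + b → j < a + c → k < b + c → a ≤ i + j → i + j + k ≡ suc m →
                     bit (enters grid i j) + (bit (prevY grid i j) + bit (is Z (grid i j))) ≡ 1
      conserve-mid i j k i< j< k< a≤ sum with injective⇒surjective sameLength injective
          (index (H⁺ i< j< k< sum))
      ... | r , fr≡ = bits (enters≡ i i< a≤ sum φr) (prevY≡ j j< sum φr) (isZ≡ k k< sum φr) (one (way r))
        where
        φr : List.lookup H (f r) ≡ (i , j , k)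
        φr = trans (cong (List.lookup H) fr≡) (sym (lookup-index (H⁺ i< j< k< sum)))
        from : ∀ D {i j k} (p : (i , j , k) ∈ L) → List.lookup H (f r) ≡ move D (i , j , k) →
            is D (grid i j) ≡ is D (way r)
        from D p eq = trans (cong (is D) (grid-∈ p))
            (same D r (index p) (trans (cong (move D) (sym (lookup-index p))) (sym eq)))
        enters≡ : ∀ i → i < a + b → a ≤ i + j → i + j + k ≡ suc m → List.lookup H (f r) ≡ (i , j , k) →
            enters grid i j ≡ is X (way r)
        enters≡ zero    _  a≤ _   eq = trans (¬T⇒≡false (≤⇒≯ a≤ ∘ <ᵇ⇒< j a))
            (sym (noX (way r) _ (trans (sym eq) (proj₂ (adjacent r)))))
        enters≡ (suc i) i< _  sum eq = from X (L⁺ (<⇒≤ i<) j< k< (suc-injective sum)) eq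
        prevY≡ : ∀ j → j < a + c → i + j + k ≡ suc m → List.lookup H (f r) ≡ (i , j , k) →
            prevY grid i j ≡ is Y (way r)
        prevY≡ zero    _  _   eq = sym (noY (way r) _ (trans (sym eq) (proj₂ (adjacent r))))
        prevY≡ (suc j) j< sum eq = from Y (L⁺ i< (<⇒≤ j<) k<
            (suc-injective (trans (cong (_+ k) (sym (+-suc i j))) sum))) eq
        isZ≡ : ∀ k → k < b + c → i + j + k ≡ suc m → List.lookup H (f r) ≡ (i , j , k) →
            is Z (grid i j) ≡ is Z (way r)
        isZ≡ zero    _  sum eq = trans (cong (is Z) (grid-out (tooHigh
            (lin 0 (≤-reflexive (sym m+2) ⊕ ≤-reflexive (sym sum)) (solve (i ∷ j ∷ m ∷ a ∷ b ∷ c ∷ []))))))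
          (sym (noZ (way r) _ (trans (sym eq) (proj₂ (adjacent r)))))
        isZ≡ (suc k) k< sum eq = from Z (L⁺ i< j< (<⇒≤ k<) (suc-injective (trans (sym (+-suc (i + j) k)) sum)))
            eq

      conserve : ∀ i j → i < a + b → j < a + c →
                 bit (enters grid i j) + (bit (prevY grid i j) + bit (is Z (grid i j))) ≡ 1
      conserve i j i< j< with i + j <? a
      ... | yes lo = conserve-low i j i< j< lo
      ... | no ¬lo with a + b + c ≤? i + j
      ...   | yes hi = conserve-high i j i< j< hi
      ...   | no ¬hi with m≤n⇒∃[o]m+o≡n {i + j} {suc m} (s≤s⁻¹ (≤-trans (≰⇒> ¬hi) (≤-reflexive (sym m+2))))
      ...     | k , sum = conserve-mid i j k i< j<
                (lin 0 (≮⇒≥ ¬lo ⊕ ≤-reflexive sum ⊕ ≤-reflexive m+2) (solve (i ∷ j ∷ k ∷ m ∷ a ∷ b ∷ c ∷ [])))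
                    (≮⇒≥ ¬lo) sum

      -- On the last level a point with `c ≤ j` has too large a degree and moves by X by convention,
      -- while a point with `j < c` lies in `L` and its x-move vanishes in the ring.
      exit : ∀ i j → suc i ≡ a + b → j < a + c → is X (grid i j) ≡ (c ≤ᵇ j)
      exit i j i≡ j< with c ≤? j
      ... | yes c≤j = trans (cong (is X) (grid-out
          (tooHigh (lin 0 (c≤j ⊕ ≤-reflexive (sym i≡)) (solve (i ∷ j ∷ a ∷ b ∷ c ∷ []))))))
                            (sym (T⇒≡true (≤⇒≤ᵇ c≤j)))
      ... | no ¬c≤j with m≤n⇒∃[o]m+o≡n (≰⇒> ¬c≤j)
      ...   | k , eq = trans (cong (is X) (grid-∈ p)) (trans notX (sym (¬T⇒≡false (¬c≤j ∘ ≤ᵇ⇒≤ c j))))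
        where
        p : (i , j , k) ∈ L
        p = L⁺ (≤-reflexive i≡) j< (lin (j + b) (≤-reflexive eq) (solve (j ∷ k ∷ b ∷ c ∷ [])))
               (+-cancelˡ-≡ 2 (i + j + k) m (trans
                   (trans {j = suc i + (suc j + k)} (solve (i ∷ j ∷ k ∷ [])) (cong₂ _+_ i≡ eq)) (sym m+2)))
        notX : is X (way (index p)) ≡ false
        notX with way (index p) in w
        ... | X = ⊥-elim (<-irrefl i≡ (proj₁ (H⁻ (target p w))))
        ... | Y = refl
        ... | Z = refl

  -- A direction is determined by its source and target, so the grid depends on the values of `f`
  -- and not on the chosen adjacency evidence.
  grid-unique : ∀ {f f′} (F : IsMatching f) (F′ : IsMatching f′) → (∀ r → f r ≡ f′ r) →
                ∀ i j → IsMatching.grid F i j ≡ IsMatching.grid F′ i j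
  grid-unique F F′ f≡f′ i j with (i , j , m ∸ (i + j)) ∈? L
  ... | no _  = refl
  ... | yes p = move-dir (List.lookup L (index p)) (trans (sym (proj₂ (IsMatching.adjacent F (index p))))
    (trans (cong (List.lookup H) (f≡f′ (index p))) (proj₂ (IsMatching.adjacent F′ (index p)))))

  -- From height functions to matchings

  module HeightToMatching {N : ℕ → ℕ → ℕ} (Nh : IsHeight N) where
    open IsHeight Nh

    dirᴹ : Monomial → Dir
    dirᴹ (i , j , k) = dir N i j

    -- A move can leave the ring only where an exponent is maximal, and there the boundary heights
    -- forbid it: `end` together with the degree excludes X, the bounds `N≤a` and `∸c≤N` exclude Y,
    -- and `low` excludes Z.
    target∈ : ∀ {μ} → μ ∈ L → move (dirᴹ μ) μ ∈ H
    target∈ {i , j , k} p with L⁻ p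
    ... | i< , j< , k< , sum = go (dir-classified N i j)
      where
      go : ∀ {D} → Classified (N (suc i) j) (N (suc i) (suc j)) (N i (suc j)) D → move D (i , j , k) ∈ H
      go (isX h) with m≤n⇒m<n∨m≡n i<
      ... | inj₁ i<′ = H⁺ i<′ j< k< (cong suc sum)
      ... | inj₂ i≡ = ⊥-elim (<-irrefl refl (≤-trans (s≤s c≤j) j<c))
        where
        N≡ : ∀ {x} → x ≤ a + c → N (suc i) x ≡ x ∸ c
        N≡ {x} x≤ = trans (cong (λ u → N u x) i≡) (end x≤)
        c≤j : c ≤ j
        c≤j with c ≤? j
        ... | yes c≤j = c≤j
        ... | no ¬c≤j = ⊥-elim (n≮0 (subst (N (suc i) j <_) (trans (N≡ j<) (m≤n⇒m∸n≡0 (≰⇒> ¬c≤j))) h))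
        j<c : j < c
        j<c = lin k (≤-reflexive sum ⊕ ≤-reflexive m+2 ⊕ ≤-reflexive (sym i≡))
            (solve (i ∷ j ∷ k ∷ m ∷ a ∷ b ∷ c ∷ []))
      go (isY _ h) with m≤n⇒m<n∨m≡n j<
      ... | inj₁ j<′ = H⁺ i< j<′ k< (trans (cong (_+ k) (+-suc i j)) (cong suc sum))
      ... | inj₂ j≡ = ⊥-elim (<-irrefl refl (≤-trans h (≤-trans (N≤a (<⇒≤ i<) j<)
                 (≤-trans (≤-reflexive (sym (trans (cong (_∸ c) j≡) (m+n∸n≡m a c)))) (∸c≤N i< j<)))))
      go (isZ h h′) with m≤n⇒m<n∨m≡n k<
      ... | inj₁ k<′ = H⁺ i< j< k<′ (trans (+-suc (i + j) k) (cong suc sum))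
      ... | inj₂ k≡ = ⊥-elim (<-irrefl refl (≤-trans (low i (suc j)
               (lin 0 (≤-reflexive sum ⊕ ≤-reflexive m+2 ⊕ ≤-reflexive (sym k≡))
                   (solve (i ∷ j ∷ k ∷ m ∷ a ∷ b ∷ c ∷ []))))
               (≤-trans h′ (≤-trans h (N≤j i< (<⇒≤ j<))))))

    -- Two different moves into one target would contradict an inequality for the heights around it:
    -- `step` for X against Y, `anti` for X against Z, and `mono` for Y against Z.
    clash-XY : ∀ {i j} → suc i < a + b → j < a + c → N (suc i) j < N (suc i) (suc j) →
        ¬ (N (suc (suc i)) j < N (suc i) j)
    clash-XY i< j< hX hY = <-irrefl refl (≤-trans hX (≤-trans (step i< j<) hY))

    clash-XZ : ∀ {i j} → suc i < a + b → j < a + c → N (suc i) j < N (suc i) (suc j) →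
        ¬ (N (suc i) (suc j) ≤ N (suc (suc i)) j)
    clash-XZ i< j< hX hZ = <-irrefl refl (≤-trans hX (≤-trans hZ (anti i< (<⇒≤ j<))))

    clash-YZ : ∀ {i j} → i < a + b → suc j < a + c → N (suc i) (suc j) < N i (suc j) →
        ¬ (N i (suc (suc j)) ≤ N (suc i) (suc j))
    clash-YZ i< j< hY hZ = <-irrefl refl (≤-trans hY (≤-trans (mono (<⇒≤ i<) j<) hZ))

    move-clash : ∀ {i j k i′ j′ k′ D D′} → i < a + b → j < a + c → i′ < a + b → j′ < a + c →
      Classified (N (suc i) j) (N (suc i) (suc j)) (N i (suc j)) D →
      Classified (N (suc i′) j′) (N (suc i′) (suc j′)) (N i′ (suc j′)) D′ →
      move D (i , j , k) ≡ move D′ (i′ , j′ , k′) → (i , j , k) ≡ (i′ , j′ , k′)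
    move-clash i< j< i<′ j<′ (isX _)   (isX _)     refl = refl
    move-clash i< j< i<′ j<′ (isY _ _) (isY _ _)   refl = refl
    move-clash i< j< i<′ j<′ (isZ _ _) (isZ _ _)   refl = refl
    move-clash i< j< i<′ j<′ (isX h)   (isY _ h′)  refl = ⊥-elim (clash-XY i<′ j< h h′)
    move-clash i< j< i<′ j<′ (isY _ h) (isX h′)    refl = ⊥-elim (clash-XY i< j<′ h′ h)
    move-clash i< j< i<′ j<′ (isX h)   (isZ h₁ h₂) refl = ⊥-elim (clash-XZ i<′ j<′ h (≤-trans h₂ h₁))
    move-clash i< j< i<′ j<′ (isZ h₁ h₂) (isX h)   refl = ⊥-elim (clash-XZ i< j< h (≤-trans h₂ h₁))
    move-clash i< j< i<′ j<′ (isY _ h) (isZ h₁ h₂) refl = ⊥-elim (clash-YZ i< j<′ h (≤-trans h₂ h₁))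
    move-clash i< j< i<′ j<′ (isZ h₁ h₂) (isY _ h) refl = ⊥-elim (clash-YZ i<′ j< h (≤-trans h₂ h₁))

    match : Fin (length L) → Fin (length H)
    match r = index (target∈ (∈-lookup r))

    match-adjacent : ∀ r → List.lookup H (match r) ≡ move (dirᴹ (List.lookup L r)) (List.lookup L r)
    match-adjacent r = sym (lookup-index (target∈ (∈-lookup r)))

    isMatching : IsMatching match
    isMatching = record
      { injective = λ {r} {s} eq → lookup-injective L! (source (∈-lookup r) (∈-lookup s)
          (trans (sym (match-adjacent r)) (trans (cong (List.lookup H) eq) (match-adjacent s))))
      ; adjacent  = λ r → dirᴹ (List.lookup L r) , match-adjacent r
      }
      where
      source : ∀ {μ ν} → μ ∈ L → ν ∈ L → move (dirᴹ μ) μ ≡ move (dirᴹ ν) ν → μ ≡ ν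
      source {i , j , k} {i′ , j′ , k′} p q with L⁻ p | L⁻ q
      ... | i< , j< , _ | i<′ , j<′ , _ = move-clash i< j< i<′ j<′ (dir-classified N i j)
          (dir-classified N i′ j′)

    dir≡X : ∀ {i j} → N (suc i) j < N (suc i) (suc j) → dir N i j ≡ X
    dir≡X {i} {j} h = go (dir-classified N i j)
      where
      go : ∀ {D} → Classified (N (suc i) j) (N (suc i) (suc j)) (N i (suc j)) D → D ≡ X
      go (isX _)    = refl
      go (isY h′ _) = ⊥-elim (≤⇒≯ h′ h)
      go (isZ h′ _) = ⊥-elim (≤⇒≯ h′ h)

    -- Outside `L` the grid is X by convention, and `dir` is X as well, because in either corner the
    -- forced heights grow by one with `j`: by `low` when `k` would be too large, by `high` when
    -- `i + j` exceeds `m`.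
    grid≡dir : ∀ {i j} → i < a + b → j < a + c → IsMatching.grid isMatching i j ≡ dir N i j
    grid≡dir {i} {j} i< j< with (i , j , m ∸ (i + j)) ∈? L
    ... | yes p = cong dirᴹ (sym (lookup-index p))
    ... | no ¬p = sym (dir≡X increases)
      where
      increases : N (suc i) j < N (suc i) (suc j)
      increases with i + j ≤? m
      ... | no ¬≤m = ≤-trans (s≤s (high i< (<⇒≤ j<) abc≤))
          (≤-trans (≤-reflexive (sym (+-∸-assoc 1 c≤j))) (∸c≤N i< j<))
        where
        abc≤ : a + b + c ≤ suc i + j
        abc≤ = lin 0 (≰⇒> ¬≤m ⊕ ≤-reflexive (sym m+2)) (solve (i ∷ j ∷ m ∷ a ∷ b ∷ c ∷ []))
        c≤j : c ≤ j
        c≤j = lin 0 (abc≤ ⊕ i<) (solve (i ∷ j ∷ a ∷ b ∷ c ∷ []))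
      ... | yes ≤m = ≤-trans (s≤s (N≤j i< (<⇒≤ j<)))
          (low (suc i) (suc j) (small (m ∸ (i + j)) (m+[n∸m]≡n ≤m) ¬p))
        where
        small : ∀ k → i + j + k ≡ m → (i , j , k) ∉ L → suc i + suc j ≤ a
        small k sum ∉L with k <? b + c
        ... | yes k< = ⊥-elim (∉L (L⁺ i< j< k< sum))
        ... | no k≮ = lin 0 (≮⇒≥ k≮ ⊕ ≤-reflexive sum ⊕ ≤-reflexive m+2)
            (solve (i ∷ j ∷ k ∷ m ∷ a ∷ b ∷ c ∷ []))

-- Inversions

sum-<ᵇ : ∀ {n} x → x ≤ n → sum {n} (λ r → bit (toℕ r <ᵇ x)) ≡ x
sum-<ᵇ {n}     zero    _       = trans (sum-cong-≗ {n} λ r → cong bit (¬T⇒≡false (n≮0 ∘ <ᵇ⇒< (toℕ r) 0)))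
    (sum-replicate-zero n)
sum-<ᵇ {suc n} (suc x) (s≤s h) = cong suc (sum-<ᵇ {n} x h)

degree : Monomial → ℕ
degree (i , j , k) = i + j + k

level₁ : Monomial → ℕ
level₁ (i , j , k) = i

-- Within one degree the third exponent is determined by the other two, so this comparison already
-- decides `≺`.
LexXY : Monomial → Monomial → Set
LexXY (i , j , _) (i′ , j′ , _) = i < i′ ⊎ (i ≡ i′ × j < j′)

≺⇒LexXY : ∀ {μ ν} → degree μ ≡ degree ν → μ ≺ ν → LexXY μ ν
≺⇒LexXY eq (inj₁ h)                            = inj₁ h
≺⇒LexXY eq (inj₂ (e , inj₁ h))              = inj₂ (e , h)
≺⇒LexXY {i , j , k} eq (inj₂ (refl , inj₂ (refl , h))) = ⊥-elim (<-irrefl (+-cancelˡ-≡ (i + j) _ _ eq) h)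

-- A y- or z-move of the smaller monomial keeps its first exponent and raises the second by at most
-- one, while the larger monomial loses nothing; the two may meet but cannot change places.
LexXY-shift : ∀ {i j i′ j′ p q p′ q′} → i ≡ p → q ≤ suc j → i′ ≤ p′ → j′ ≤ q′ →
  i < i′ ⊎ (i ≡ i′ × j < j′) → ¬ (p′ < p ⊎ (p′ ≡ p × q′ < q))
LexXY-shift refl q≤ i′≤ j′≤ (inj₁ h)          (inj₁ h′)          =
    <-irrefl refl (<-trans h (≤-trans (s≤s i′≤) h′))
LexXY-shift refl q≤ i′≤ j′≤ (inj₁ h)          (inj₂ (refl , _))  = <-irrefl refl (≤-trans h i′≤)
LexXY-shift refl q≤ i′≤ j′≤ (inj₂ (refl , h)) (inj₁ h′)          = <-irrefl refl (≤-trans h′ i′≤)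
LexXY-shift refl q≤ i′≤ j′≤ (inj₂ (_ , h))    (inj₂ (_ , h′))    =
  <-irrefl refl (≤-trans h′ (≤-trans q≤ (≤-trans h j′≤)))

-- An inversion can only pair an x-edge, at the smaller monomial, with a y- or z-edge.
no-inversion : ∀ D D′ {μ μ′} → D ≢ X ⊎ D′ ≡ X → LexXY μ μ′ → ¬ LexXY (move D′ μ′) (move D μ)
no-inversion X X _ h (inj₁ h′) with h
... | inj₁ h″          = <-asym h″ (s≤s⁻¹ h′)
... | inj₂ (refl , _)  = <-irrefl refl h′
no-inversion X X _ h (inj₂ (refl , h′)) with h
... | inj₁ h″          = <-irrefl refl h″
... | inj₂ (_ , h″)    = <-asym h″ h′
no-inversion X D′ (inj₁ ¬X) = ⊥-elim (¬X refl)
no-inversion X Y (inj₂ ())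
no-inversion X Z (inj₂ ())
no-inversion Y X _ = LexXY-shift refl ≤-refl (n≤1+n _) ≤-refl
no-inversion Y Y _ = LexXY-shift refl ≤-refl ≤-refl (n≤1+n _)
no-inversion Y Z _ = LexXY-shift refl ≤-refl ≤-refl ≤-refl
no-inversion Z X _ = LexXY-shift refl (n≤1+n _) (n≤1+n _) ≤-refl
no-inversion Z Y _ = LexXY-shift refl (n≤1+n _) ≤-refl (n≤1+n _)
no-inversion Z Z _ = LexXY-shift refl (n≤1+n _) ≤-refl ≤-refl

invᵇ : ∀ {n n′} → (Fin n → Fin n′) → Fin n → Fin n → Bool
invᵇ f r s = (toℕ r <ᵇ toℕ s) ∧ (toℕ (f s) <ᵇ toℕ (f r))

module Signs (L H : List Monomial) (Lₛ : AllPairs _≺_ L) (Hₛ : AllPairs _≺_ H) (m d : ℕ)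
  (degL : ∀ r → degree (List.lookup L r) ≡ m) (degH : ∀ s → degree (List.lookup H s) ≡ suc m)
  (position : ∀ r s → List.lookup H s ≡ move X (List.lookup L r) → toℕ s ≡ d + toℕ r)
  (f : Fin (length L) → Fin (length H)) (f-inj : ∀ {r s} → f r ≡ f s → r ≡ s) (f-surj : ∀ s → ∃ λ r → f r ≡ s)
  (way : Fin (length L) → Dir) (f-way : ∀ r → List.lookup H (f r) ≡ move (way r) (List.lookup L r))
  where

  not-inverted : ∀ {r s} → r Fin.< s → way r ≢ X ⊎ way s ≡ X → ¬ (f s Fin.< f r)
  not-inverted {r} {s} r<s w fs<fr = no-inversion (way r) (way s) w
    (≺⇒LexXY (trans (degL r) (sym (degL s))) (AllPairs-lookup Lₛ r<s))
    (subst₂ LexXY (f-way s) (f-way r) (≺⇒LexXY (trans (degH (f s)) (sym (degH (f r))))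
        (AllPairs-lookup Hₛ fs<fr)))

  increasing-to-X : ∀ {s r} → s Fin.< r → way r ≡ X → f s Fin.< f r
  increasing-to-X {s} {r} s<r w with Finₚ.<-cmp (f s) (f r)
  ... | tri< h _ _ = h
  ... | tri≈ _ h _ = ⊥-elim (Finₚ.<⇒≢ s<r (f-inj h))
  ... | tri> _ _ h = ⊥-elim (not-inverted s<r (inj₂ w) h)

  f-permutation : Permutation (length L) (length H)
  f-permutation = permutation f (proj₁ ∘ f-surj) (proj₂ ∘ f-surj) (λ r → f-inj (proj₂ (f-surj (f r))))

  reindex : ∀ (g : Fin (length H) → ℕ) → sum (g ∘ f) ≡ sum g
  reindex g = sym (sum-permute g f-permutation)

  -- Every `s < r` lands below `f r`, by `increasing-to-X`. The positions below `f r` are therefore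
  -- the images of all `s < r` together with the images of those later `s` that form an inversion
  -- with `r`.
  inv-X : ∀ r → way r ≡ X → sum (bit ∘ invᵇ f r) + toℕ r ≡ toℕ (f r)
  inv-X r w = trans (cong (sum (bit ∘ invᵇ f r) +_) (sym (sum-<ᵇ (toℕ r) (<⇒≤ (toℕ<n r)))))
    (trans (sym (∑-distrib-+ (bit ∘ invᵇ f r) (λ s → bit (toℕ s <ᵇ toℕ r))))
    (trans (sum-cong-≗ pointwise)
    (trans (reindex (λ t → bit (toℕ t <ᵇ toℕ (f r)))) (sum-<ᵇ (toℕ (f r)) (<⇒≤ (toℕ<n (f r)))))))
    where
    pointwise : ∀ s → bit (invᵇ f r s) + bit (toℕ s <ᵇ toℕ r) ≡ bit (toℕ (f s) <ᵇ toℕ (f r))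
    pointwise s with Finₚ.<-cmp s r
    ... | tri≈ _ refl _ rewrite ¬T⇒≡false (n≮n (toℕ r) ∘ <ᵇ⇒< (toℕ r) (toℕ r)) | ¬T⇒≡false
        (n≮n (toℕ (f r)) ∘ <ᵇ⇒< (toℕ (f r)) (toℕ (f r))) = refl
    ... | tri> s≮r _ r<s rewrite T⇒≡true (<⇒<ᵇ r<s) | ¬T⇒≡false (s≮r ∘ <ᵇ⇒< (toℕ s) (toℕ r)) = +-identityʳ _
    ... | tri< s<r _ r≮s rewrite ¬T⇒≡false (r≮s ∘ <ᵇ⇒< (toℕ r) (toℕ s)) | T⇒≡true (<⇒<ᵇ s<r) | T⇒≡true
        (<⇒<ᵇ (increasing-to-X s<r w)) = refl

  inv-¬X : ∀ r → way r ≢ X → sum (bit ∘ invᵇ f r) ≡ 0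
  inv-¬X r w = trans (sum-cong-≗ pointwise) (sum-replicate-zero (length L))
    where
    pointwise : ∀ s → bit (invᵇ f r s) ≡ 0
    pointwise s with toℕ r <? toℕ s
    ... | yes r<s = cong bit (trans (cong ((toℕ r <ᵇ toℕ s) ∧_)
        (¬T⇒≡false (not-inverted r<s (inj₁ w) ∘ <ᵇ⇒< _ _))) (∧-zeroʳ _))
    ... | no r≮s  = cong (λ u → bit (u ∧ (toℕ (f s) <ᵇ toℕ (f r)))) (¬T⇒≡false (r≮s ∘ <ᵇ⇒< _ _))

  -- By `inv-X` and `position` an x-edge starts `d` inversions, and it raises the level by one;
  -- other edges do neither. Stating this with sums avoids truncated subtraction.
  inv-level : ∀ r → sum (bit ∘ invᵇ f r) + level₁ (List.lookup L r) * d ≡ level₁ (List.lookup H (f r)) * d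
  inv-level r = go (way r) refl
    where
    φ : ∀ D → way r ≡ D → List.lookup H (f r) ≡ move D (List.lookup L r)
    φ D w = trans (f-way r) (cong (λ D → move D (List.lookup L r)) w)
    flat : ∀ D → D ≢ X → level₁ (move D (List.lookup L r)) ≡ level₁ (List.lookup L r)
    flat X ¬X = ⊥-elim (¬X refl)
    flat Y _  = refl
    flat Z _  = refl
    nonX : ∀ D → way r ≡ D → D ≢ X → sum (bit ∘ invᵇ f r) + level₁ (List.lookup L r) * d ≡ level₁
        (List.lookup H (f r)) * d
    nonX D w ¬X = cong₂ _+_ (inv-¬X r (¬X ∘ trans (sym w)))
        (cong (_* d) (sym (trans (cong level₁ (φ D w)) (flat D ¬X))))
    go : ∀ D → way r ≡ D → sum (bit ∘ invᵇ f r) + level₁ (List.lookup L r) * d ≡ level₁ (List.lookup H (f r)) *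
        d
    go X w = trans (cong (_+ level₁ (List.lookup L r) * d)
      (+-cancelʳ-≡ (toℕ r) _ _ (trans (inv-X r w) (position r (f r) (φ X w)))))
          (cong (_* d) (sym (cong level₁ (φ X w))))
    go Y w = nonX Y w λ ()
    go Z w = nonX Z w λ ()

  -- Reindexing along the bijection `f` turns the sum over targets into a sum over all of `H`, which
  -- no longer mentions the matching.
  inv-total : sum (λ r → sum (bit ∘ invᵇ f r)) + sum (λ r → level₁ (List.lookup L r) * d) ≡ sum
      (λ s → level₁ (List.lookup H s) * d)
  inv-total = trans (sym (∑-distrib-+ (λ r → sum (bit ∘ invᵇ f r)) (λ r → level₁ (List.lookup L r) * d)))
    (trans (sum-cong-≗ inv-level) (reindex (λ s → level₁ (List.lookup H s) * d)))

-- Opened only here because the prefix +_ of ℤ makes sections of _+_ on ℕ ambiguous.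
open import Data.Integer as ℤ using (ℤ; +_; -_; ∣_∣)
open import Data.Integer.Properties as ℤₚ using ()
open import Data.Vec using (Vec; []; _∷_; lookup; tabulate; replicate)
open import Data.Vec.Properties using (lookup∘tabulate; tabulate∘lookup; tabulate-cong; ∷-injective)

-- Permutations, terms and enumerations

∧⁺ : ∀ {x y} → T x → T y → T (x ∧ y)
∧⁺ {true} _ h = h

∧⁻ : ∀ {x y} → T (x ∧ y) → T x × T y
∧⁻ {true} h = tt , h

allFin⁺ : ∀ {n} {p : Fin n → Bool} → (∀ i → T (p i)) → T (all p (allFin n))
allFin⁺ {n} {p} h = go (allFin n)
  where
  go : ∀ xs → T (all p xs)
  go []       = tt
  go (x ∷ xs) = ∧⁺ (h x) (go xs)

allFin⁻ : ∀ {n} {p : Fin n → Bool} → T (all p (allFin n)) → ∀ i → T (p i)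
allFin⁻ {n} {p} h i = go (allFin n) h (∈-allFin i)
  where
  go : ∀ xs → T (all p xs) → i ∈ xs → T (p i)
  go (x ∷ xs) h (here refl) = proj₁ (∧⁻ h)
  go (x ∷ xs) h (there q)   = go xs (proj₂ (∧⁻ {p x} h)) q

⇒ᵇ⁺ : ∀ {x y} → (T x → T y) → T (not x ∨ y)
⇒ᵇ⁺ {true}  h = h tt
⇒ᵇ⁺ {false} _ = tt

⇒ᵇ⁻ : ∀ {x y} → T (not x ∨ y) → T x → T y
⇒ᵇ⁻ {true} h _ = h

Vec-ext : ∀ {A : Set} {n} {u v : Vec A n} → (∀ i → lookup u i ≡ lookup v i) → u ≡ v
Vec-ext {u = u} {v} h = trans (sym (tabulate∘lookup u)) (trans (tabulate-cong h) (tabulate∘lookup v))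

Σ-T-≡ : ∀ {A : Set} (p : A → Bool) {s t : Σ A (T ∘ p)} → proj₁ s ≡ proj₁ t → s ≡ t
Σ-T-≡ p {x , _} refl = cong (x ,_) (T-irrelevant _ _)

module _ {n : ℕ} (σ : Vec (Fin n) n) where

  isPerm⁻ : T (isPermᵇ σ) → ∀ {i j} → lookup σ i ≡ lookup σ j → i ≡ j
  isPerm⁻ h {i} {j} eq with toℕ i ≡ᵇ toℕ j in e | allFin⁻ (allFin⁻ h i) j
  ... | true  | _  = toℕ-injective (≡ᵇ⇒≡ (toℕ i) (toℕ j) (subst T (sym e) tt))
  ... | false | h′ with toℕ (lookup σ i) ≡ᵇ toℕ (lookup σ j) in e′
  ...   | false = ⊥-elim (subst T e′ (≡⇒≡ᵇ _ _ (cong toℕ eq)))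

  isPerm⁺ : (∀ {i j} → lookup σ i ≡ lookup σ j → i ≡ j) → T (isPermᵇ σ)
  isPerm⁺ inj = allFin⁺ λ i → allFin⁺ λ j → pair i j
    where
    pair : ∀ i j → T (eqFin i j ∨ not (eqFin (lookup σ i) (lookup σ j)))
    pair i j with eqFin (lookup σ i) (lookup σ j) in e
    ... | true rewrite T⇒≡true (≡⇒≡ᵇ (toℕ i) (toℕ j)
        (cong toℕ (inj (toℕ-injective (≡ᵇ⇒≡ _ _ (subst T (sym e) tt)))))) = tt
    ... | false with eqFin i j
    ...   | true  = tt
    ...   | false = tt

eqMon⁻ : ∀ μ ν → eqMon μ ν ≡ true → μ ≡ ν
eqMon⁻ (i , j , k) (i′ , j′ , k′) e with ∧⁻ {i ≡ᵇ i′} (subst T (sym e) tt)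
... | h , h′ with ∧⁻ {j ≡ᵇ j′} h′
...   | h₁ , h₂ = cong₂ _,_ (≡ᵇ⇒≡ i i′ h) (cong₂ _,_ (≡ᵇ⇒≡ j j′ h₁) (≡ᵇ⇒≡ k k′ h₂))

eqMon-refl : ∀ μ → eqMon μ μ ≡ true
eqMon-refl (i , j , k) = T⇒≡true (∧⁺ (≡⇒≡ᵇ i i refl) (∧⁺ {j ≡ᵇ j} (≡⇒≡ᵇ j j refl) (≡⇒≡ᵇ k k refl)))

-- Different moves of one monomial are different, so at most one of the three summands is 1.
coeffMul-cases : ∀ μ ν → coeffMul μ ν ≡ + 0 ⊎ (coeffMul μ ν ≡ + 1 × Σ Dir λ D → ν ≡ move D μ)
coeffMul-cases μ ν with eqMon (move X μ) ν in eX | eqMon (move Y μ) ν in eY | eqMon (move Z μ) ν in eZ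
... | false | false | false = inj₁ refl
... | true  | false | false = inj₂ (refl , X , sym (eqMon⁻ (move X μ) ν eX))
... | false | true  | false = inj₂ (refl , Y , sym (eqMon⁻ (move Y μ) ν eY))
... | false | false | true  = inj₂ (refl , Z , sym (eqMon⁻ (move Z μ) ν eZ))
... | true  | true  | _     with () ← move-dir {X} {Y} μ
    (trans (eqMon⁻ (move X μ) ν eX) (sym (eqMon⁻ (move Y μ) ν eY)))
... | true  | false | true  with () ← move-dir {X} {Z} μ
    (trans (eqMon⁻ (move X μ) ν eX) (sym (eqMon⁻ (move Z μ) ν eZ)))
... | false | true  | true  with () ← move-dir {Y} {Z} μ
    (trans (eqMon⁻ (move Y μ) ν eY) (sym (eqMon⁻ (move Z μ) ν eZ)))

coeffMul-move : ∀ D μ → coeffMul μ (move D μ) ≢ + 0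
coeffMul-move X μ eq rewrite eqMon-refl (move X μ)
  with eqMon (move Y μ) (move X μ) | eqMon (move Z μ) (move X μ)
coeffMul-move X μ () | true  | true
coeffMul-move X μ () | true  | false
coeffMul-move X μ () | false | true
coeffMul-move X μ () | false | false
coeffMul-move Y μ eq rewrite eqMon-refl (move Y μ)
  with eqMon (move X μ) (move Y μ) | eqMon (move Z μ) (move Y μ)
coeffMul-move Y μ () | true  | true
coeffMul-move Y μ () | true  | false
coeffMul-move Y μ () | false | true
coeffMul-move Y μ () | false | false
coeffMul-move Z μ eq rewrite eqMon-refl (move Z μ)
  with eqMon (move X μ) (move Z μ) | eqMon (move Y μ) (move Z μ)
coeffMul-move Z μ () | true  | true
coeffMul-move Z μ () | true  | false
coeffMul-move Z μ () | false | true
coeffMul-move Z μ () | false | false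

prodℤ-01 : ∀ {A : Set} (g : A → ℤ) → (∀ x → g x ≡ + 0 ⊎ g x ≡ + 1) → ∀ xs →
  (prodℤ (map g xs) ≡ + 0 × ∃ λ x → g x ≡ + 0) ⊎ (prodℤ (map g xs) ≡ + 1 × (∀ {x} → x ∈ xs → g x ≡ + 1))
prodℤ-01 g h [] = inj₂ (refl , λ ())
prodℤ-01 g h (x ∷ xs) with h x
... | inj₁ gx≡0 = inj₁ (trans (cong (ℤ._* prodℤ (map g xs)) gx≡0) (ℤₚ.*-zeroˡ (prodℤ (map g xs))) , x , gx≡0)
... | inj₂ gx≡1 with prodℤ-01 g h xs
...   | inj₁ (p , w) = inj₁ (trans (cong₂ ℤ._*_ gx≡1 p) refl , w)
...   | inj₂ (p , w) = inj₂ (trans (cong₂ ℤ._*_ gx≡1 p) refl , λ { (here refl) → gx≡1 ; (there q) → w q })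

nonzeroᵇ : ∀ {n} → Matrix n → Vec (Fin n) n → Bool
nonzeroᵇ M σ = isPermᵇ σ ∧ not (does (term M σ ℤ.≟ + 0))

module _ {n : ℕ} (M : Matrix n) (M01 : ∀ r s → M r s ≡ + 0 ⊎ M r s ≡ + 1) where

  term-cases : ∀ σ → (term M σ ≡ + 0 × ∃ λ r → M r (lookup σ r) ≡ + 0) ⊎
      (term M σ ≡ + 1 × (∀ r → M r (lookup σ r) ≡ + 1))
  term-cases σ with prodℤ-01 (λ r → M r (lookup σ r)) (λ r → M01 r (lookup σ r)) (allFin n)
  ... | inj₁ h       = inj₁ h
  ... | inj₂ (p , w) = inj₂ (p , λ r → w (∈-allFin r))

  nonzero⁻ : ∀ σ → T (nonzeroᵇ M σ) → T (isPermᵇ σ) × (∀ r → M r (lookup σ r) ≡ + 1)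
  nonzero⁻ σ h with ∧⁻ {isPermᵇ σ} h | term-cases σ
  ... | p , q | inj₂ (_ , w) = p , w
  ... | p , q | inj₁ (e , _) = ⊥-elim (subst (λ u → T (not (does (u ℤ.≟ + 0)))) e q)

  nonzero⁺ : ∀ σ → T (isPermᵇ σ) → (∀ r → M r (lookup σ r) ≢ + 0) → T (nonzeroᵇ M σ)
  nonzero⁺ σ p w with term-cases σ
  ... | inj₁ (_ , r , z) = ⊥-elim (w r z)
  ... | inj₂ (e , _)     = ∧⁺ p (subst (λ u → T (not (does (u ℤ.≟ + 0)))) (sym e) tt)

  perm≡count : perm M ≡ + countᵇ (nonzeroᵇ M) (allVecs n n)
  perm≡count = go (allVecs n n)
    where
    go : ∀ xs → sumℤ (map (term M) (filterᵇ isPermᵇ xs)) ≡ + countᵇ (nonzeroᵇ M) xs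
    go [] = refl
    go (σ ∷ xs) with isPermᵇ σ
    ... | false = go xs
    ... | true with term-cases σ
    ...   | inj₁ (e , _) rewrite e = trans (ℤₚ.+-identityˡ _) (go xs)
    ...   | inj₂ (e , _) rewrite e = cong (λ u → (+ 1) ℤ.+ u) (go xs)

  -- Nonzero terms share one sign and a zero term agrees with any sign, so the sign factors out of
  -- the sum.
  det≡±perm : ∀ K → (∀ σ → T (nonzeroᵇ M σ) → inversions σ ≡ K) → det M ≡ minusOnePow K ℤ.* perm M
  det≡±perm K h = go (allVecs n n)
    where
    go : ∀ xs → sumℤ (map (λ σ → sign σ ℤ.* term M σ) (filterᵇ isPermᵇ xs)) ≡ minusOnePow K ℤ.* sumℤ
        (map (term M) (filterᵇ isPermᵇ xs))
    go [] = sym (ℤₚ.*-zeroʳ (minusOnePow K))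
    go (σ ∷ xs) with isPermᵇ σ in p
    ... | false = go xs
    ... | true  = trans (cong₂ ℤ._+_ here-eq (go xs)) (sym (ℤₚ.*-distribˡ-+ (minusOnePow K) (term M σ) _))
      where
      here-eq : sign σ ℤ.* term M σ ≡ minusOnePow K ℤ.* term M σ
      here-eq with term-cases σ
      ... | inj₁ (e , _) rewrite e = trans (ℤₚ.*-zeroʳ (sign σ)) (sym (ℤₚ.*-zeroʳ (minusOnePow K)))
      ... | inj₂ (e , w) = cong (λ u → minusOnePow u ℤ.* term M σ)
          (h σ (nonzero⁺ σ (subst T (sym p) tt) λ r z → 0≢1 (trans (sym z) (w r))))
        where
        0≢1 : + 0 ≢ + 1
        0≢1 ()

minusOnePow-±1 : ∀ K → minusOnePow K ≡ + 1 ⊎ minusOnePow K ≡ - (+ 1)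
minusOnePow-±1 zero = inj₁ refl
minusOnePow-±1 (suc K) with minusOnePow-±1 K
... | inj₁ e = inj₂ (cong -_ e)
... | inj₂ e = inj₁ (cong -_ e)

sumℕ-tabulate : ∀ {A : Set} {n} (g : A → ℕ) (t : Fin n → A) → sumℕ (map g (List.tabulate t)) ≡ sum (g ∘ t)
sumℕ-tabulate {n = zero}  g t = refl
sumℕ-tabulate {n = suc n} g t = cong (λ u → g (t Fin.zero) + u) (sumℕ-tabulate g (t ∘ Fin.suc))

countᵇ-tabulate : ∀ {A : Set} {n} (p : A → Bool) (t : Fin n → A) → countᵇ p (List.tabulate t) ≡ sum
    (bit ∘ p ∘ t)
countᵇ-tabulate {n = zero}  p t = refl
countᵇ-tabulate {n = suc n} p t with p (t Fin.zero)
... | true  = cong suc (countᵇ-tabulate p (t ∘ Fin.suc))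
... | false = countᵇ-tabulate p (t ∘ Fin.suc)

inversions≡sum : ∀ {n} (σ : Vec (Fin n) n) → inversions σ ≡ sum (λ r → sum (bit ∘ invᵇ (lookup σ) r))
inversions≡sum {n} σ = trans (sumℕ-tabulate (λ i → countᵇ (invᵇ (lookup σ) i) (allFin n)) (λ r → r))
  (sum-cong-≗ λ r → countᵇ-tabulate (invᵇ (lookup σ) r) (λ s → s))

module _ {A : Set} {n : ℕ} where

  extensions≡ : ∀ (xs : List A) (ys : List (Vec A n)) → concatMap (λ x → map (x ∷_) ys) xs ≡
      cartesianProductWith _∷_ xs ys
  extensions≡ []       ys = refl
  extensions≡ (x ∷ xs) ys = cong (map (x ∷_) ys List.++_) (extensions≡ xs ys)

  extensions-unique : ∀ {xs : List A} {ys : List (Vec A n)} → Unique xs → Unique ys →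
      Unique (concatMap (λ x → map (x ∷_) ys) xs)
  extensions-unique {xs} {ys} u v = subst Unique (sym (extensions≡ xs ys))
      (Uniqueₚ.cartesianProductWith⁺ _∷_ ∷-injective u v)

  extensions-∈ : ∀ {xs : List A} {ys : List (Vec A n)} {x y} → x ∈ xs → y ∈ ys →
      (x ∷ y) ∈ concatMap (λ x → map (x ∷_) ys) xs
  extensions-∈ {xs} {ys} {x} {y} p q = subst ((x ∷ y) ∈_) (sym (extensions≡ xs ys))
      (∈-cartesianProductWith⁺ _∷_ p q)

singleton-unique : ∀ {A : Set} {x : A} → Unique (x ∷ [])
singleton-unique = All.[] ∷ []

allVecs-unique : ∀ n k → Unique (allVecs n k)
allVecs-unique n zero    = singleton-unique
allVecs-unique n (suc k) = extensions-unique (Uniqueₚ.allFin⁺ n) (allVecs-unique n k)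

allVecs-∈ : ∀ {n k} (v : Vec (Fin n) k) → v ∈ allVecs n k
allVecs-∈ []      = here refl
allVecs-∈ (x ∷ v) = extensions-∈ (∈-allFin x) (allVecs-∈ v)

allVecsℕ-unique : ∀ c k → Unique (allVecsℕ c k)
allVecsℕ-unique c zero    = singleton-unique
allVecsℕ-unique c (suc k) = extensions-unique (Uniqueₚ.upTo⁺ (suc c)) (allVecsℕ-unique c k)

allVecsℕ-∈ : ∀ {c k} (v : Vec ℕ k) → (∀ i → lookup v i ≤ c) → v ∈ allVecsℕ c k
allVecsℕ-∈ []      h = here refl
allVecsℕ-∈ (x ∷ v) h = extensions-∈ (∈-upTo⁺ (s≤s (h Fin.zero))) (allVecsℕ-∈ v (h ∘ Fin.suc))

allArrays-unique : ∀ c a b → Unique (allArrays c a b)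
allArrays-unique c zero    b = singleton-unique
allArrays-unique c (suc a) b = extensions-unique (allVecsℕ-unique c b) (allArrays-unique c a b)

allArrays-∈ : ∀ {c a b} (π : Array a b) → (∀ i j → entry π i j ≤ c) → π ∈ allArrays c a b
allArrays-∈ []      h = here refl
allArrays-∈ (r ∷ π) h = extensions-∈ (allVecsℕ-∈ r (h Fin.zero)) (allArrays-∈ π (h ∘ Fin.suc))

module _ {A B : Set} (p : A → Bool) (q : B → Bool) {xs : List A} {ys : List B} where

  count-≤ : Unique xs → (∀ y → T (q y) → y ∈ ys) → (f : Σ A (T ∘ p) → Σ B (T ∘ q)) →
            (∀ {s t} → f s ≡ f t → s ≡ t) → countᵇ p xs ≤ countᵇ q ys
  count-≤ u complete f f-inj = length-≤ (Uniqueₚ.filter⁺ (T? ∘ p) u) (λ m → proj₁ (f′ m))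
    (λ m → ∈-filter⁺ (T? ∘ q) (complete (proj₁ (f′ m)) (proj₂ (f′ m))) (proj₂ (f′ m)))
    (λ m m′ e → cong proj₁ (f-inj (Σ-T-≡ q e)))
    where
    f′ : ∀ {x} → x ∈ filterᵇ p xs → Σ B (T ∘ q)
    f′ {x} m = f (x , proj₂ (∈-filter⁻ (T? ∘ p) {xs = xs} m))

-- As `T` has at most one proof, a filtered complete list without repetitions represents the
-- subtype; the bijection and its inverse give the two inequalities.
count-bijection : ∀ {A B : Set} (p : A → Bool) (q : B → Bool) {xs : List A} {ys : List B} → Unique xs →
    Unique ys →
  (∀ x → T (p x) → x ∈ xs) → (∀ y → T (q y) → y ∈ ys) → Σ A (T ∘ p) ⤖ Σ B (T ∘ q) → countᵇ p xs ≡ countᵇ q ys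
count-bijection p q u v cx cy F = ≤-antisym
  (count-≤ p q u cy to injective)
  (count-≤ q p v cx (proj₁ ∘ strictlySurjective) λ {s} {t} e →
    trans (sym (proj₂ (strictlySurjective s))) (trans (cong to e) (proj₂ (strictlySurjective t))))
  where open Bijection F using (to; injective; strictlySurjective)

-- Arrays

module _ {A : Set} (x₀ : A) where

  vecAt : ∀ {n} → Vec A n → ℕ → A
  vecAt []      _       = x₀
  vecAt (x ∷ v) zero    = x
  vecAt (x ∷ v) (suc p) = vecAt v p

  vecAt-lookup : ∀ {n} (v : Vec A n) i → vecAt v (toℕ i) ≡ lookup v i
  vecAt-lookup (x ∷ v) Fin.zero    = refl
  vecAt-lookup (x ∷ v) (Fin.suc i) = vecAt-lookup v i

  vecAt-out : ∀ {n} (v : Vec A n) {p} → n ≤ p → vecAt v p ≡ x₀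
  vecAt-out []      _       = refl
  vecAt-out (x ∷ v) (s≤s h) = vecAt-out v h

  vecAt-replicate : ∀ n p → vecAt (replicate n x₀) p ≡ x₀
  vecAt-replicate zero    p       = refl
  vecAt-replicate (suc n) zero    = refl
  vecAt-replicate (suc n) (suc p) = vecAt-replicate n p

module Arrays (a b : ℕ) where

  -- The default 0 keeps the columns decreasing past the last row, as `IsPP` demands.
  at : Array a b → ℕ → ℕ → ℕ
  at π p q = vecAt 0 (vecAt (replicate b 0) π p) q

  at-entry : ∀ π i j → at π (toℕ i) (toℕ j) ≡ entry π i j
  at-entry π i j = trans (cong (λ v → vecAt 0 v (toℕ j)) (vecAt-lookup (replicate b 0) π i))
      (vecAt-lookup 0 (lookup π i) j)

  at-out : ∀ π {p} q → a ≤ p → at π p q ≡ 0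
  at-out π q h = trans (cong (λ v → vecAt 0 v q) (vecAt-out (replicate b 0) π h)) (vecAt-replicate 0 b q)

  at-in : ∀ π {p q} (hp : p < a) (hq : q < b) → at π p q ≡ entry π (fromℕ< hp) (fromℕ< hq)
  at-in π hp hq = trans (sym (cong₂ (at π) (toℕ-fromℕ< hp) (toℕ-fromℕ< hq)))
      (at-entry π (fromℕ< hp) (fromℕ< hq))

  array : (ℕ → ℕ → ℕ) → Array a b
  array g = tabulate λ i → tabulate λ j → g (toℕ i) (toℕ j)

  entry-array : ∀ g i j → entry (array g) i j ≡ g (toℕ i) (toℕ j)
  entry-array g i j = trans (cong (λ v → lookup v j)
      (lookup∘tabulate (λ i → tabulate λ j → g (toℕ i) (toℕ j)) i))
                            (lookup∘tabulate (λ j → g (toℕ i) (toℕ j)) j)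

  at-array : ∀ g {p q} → p < a → q < b → at (array g) p q ≡ g p q
  at-array g hp hq = trans (at-in (array g) hp hq)
    (trans (entry-array g (fromℕ< hp) (fromℕ< hq)) (cong₂ g (toℕ-fromℕ< hp) (toℕ-fromℕ< hq)))

  array-ext : ∀ {π ρ : Array a b} → (∀ i j → entry π i j ≡ entry ρ i j) → π ≡ ρ
  array-ext h = Vec-ext λ i → Vec-ext λ j → h i j

  module _ (c : ℕ) where
    open Heights a b c using (IsPP)

    Entries : Array a b → Set
    Entries π = ∀ i j → entry π i j ≤ c × (∀ j′ → toℕ j ≤ toℕ j′ → entry π i j′ ≤ entry π i j)
                                       × (∀ i′ → toℕ i ≤ toℕ i′ → entry π i′ j ≤ entry π i j)

    rowᵇ : Array a b → Fin a → Fin b → Fin b → Bool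
    rowᵇ π i j j′ = not (toℕ j ≤ᵇ toℕ j′) ∨ (entry π i j′ ≤ᵇ entry π i j)

    columnᵇ : Array a b → Fin a → Fin b → Fin a → Bool
    columnᵇ π i j i′ = not (toℕ i ≤ᵇ toℕ i′) ∨ (entry π i′ j ≤ᵇ entry π i j)

    isPPᵇ⁻ : ∀ π → T (isPPᵇ c π) → Entries π
    isPPᵇ⁻ π h i j with ∧⁻ {entry π i j ≤ᵇ c} (allFin⁻ (allFin⁻ h i) j)
    ... | h₁ , h₂ with ∧⁻ {all (rowᵇ π i j) (allFin b)} h₂
    ...   | h₃ , h₄ = ≤ᵇ⇒≤ _ c h₁ , (λ j′ l → ≤ᵇ⇒≤ _ _
        (⇒ᵇ⁻ {toℕ j ≤ᵇ toℕ j′} (allFin⁻ {p = rowᵇ π i j} h₃ j′) (≤⇒≤ᵇ l)))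
                                  , (λ i′ l → ≤ᵇ⇒≤ _ _ (⇒ᵇ⁻ {toℕ i ≤ᵇ toℕ i′}
                                      (allFin⁻ {p = columnᵇ π i j} h₄ i′) (≤⇒≤ᵇ l)))

    isPPᵇ⁺ : ∀ π → Entries π → T (isPPᵇ c π)
    isPPᵇ⁺ π h = allFin⁺ λ i → allFin⁺ λ j → let h₁ , h₂ , h₃ = h i j in
      ∧⁺ {entry π i j ≤ᵇ c} (≤⇒≤ᵇ h₁) (∧⁺ (allFin⁺ λ j′ →
          ⇒ᵇ⁺ {toℕ j ≤ᵇ toℕ j′} (λ l → ≤⇒≤ᵇ (h₂ j′ (≤ᵇ⇒≤ (toℕ j) (toℕ j′) l))))
                                       (allFin⁺ λ i′ → ⇒ᵇ⁺ {toℕ i ≤ᵇ toℕ i′}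
                                           (λ l → ≤⇒≤ᵇ (h₃ i′ (≤ᵇ⇒≤ (toℕ i) (toℕ i′) l)))))

    at-isPP : ∀ π → Entries π → IsPP (at π)
    at-isPP π h = record { bounded = bounded ; row = row ; column = column }
      where
      bounded : ∀ p {q} → q < b → at π p q ≤ c
      bounded p {q} hq with p <? a
      ... | yes hp = subst (_≤ c) (sym (at-in π hp hq)) (proj₁ (h (fromℕ< hp) (fromℕ< hq)))
      ... | no ¬hp = subst (_≤ c) (sym (at-out π q (≮⇒≥ ¬hp))) z≤n
      row : ∀ p {q} → suc q < b → at π p (suc q) ≤ at π p q
      row p {q} hq with p <? a
      ... | yes hp = subst₂ _≤_ (sym (at-in π hp hq)) (sym (at-in π hp (<⇒≤ hq)))
                       (proj₁ (proj₂ (h (fromℕ< hp) (fromℕ< (<⇒≤ hq)))) (fromℕ< hq)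
                         (subst₂ _≤_ (sym (toℕ-fromℕ< (<⇒≤ hq))) (sym (toℕ-fromℕ< hq)) (n≤1+n q)))
      ... | no ¬hp = subst (_≤ at π p q) (sym (at-out π (suc q) (≮⇒≥ ¬hp))) z≤n
      column : ∀ p {q} → q < b → at π (suc p) q ≤ at π p q
      column p {q} hq with suc p <? a
      ... | yes hp = subst₂ _≤_ (sym (at-in π hp hq)) (sym (at-in π (<⇒≤ hp) hq))
                       (proj₂ (proj₂ (h (fromℕ< (<⇒≤ hp)) (fromℕ< hq))) (fromℕ< hp)
                         (subst₂ _≤_ (sym (toℕ-fromℕ< (<⇒≤ hp))) (sym (toℕ-fromℕ< hp)) (n≤1+n p)))
      ... | no ¬hp = subst (_≤ at π p q) (sym (at-out π q (≮⇒≥ ¬hp))) z≤n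

decreasing : ∀ (g : ℕ → ℕ) n → (∀ {q} → suc q < n → g (suc q) ≤ g q) → ∀ {q q′} → q ≤ q′ → q′ < n → g q′ ≤ g q
decreasing g n h {q} q≤q′ q′< with m≤n⇒∃[o]m+o≡n q≤q′
... | o , refl = go o q′<
  where
  go : ∀ o → q + o < n → g (q + o) ≤ g q
  go zero    _  = ≤-reflexive (cong g (+-identityʳ q))
  go (suc o) lt = ≤-trans (≤-reflexive (cong g (+-suc q o))) (≤-trans (h lt′) (go o (<⇒≤ lt′)))
    where
    lt′ : suc (q + o) < n
    lt′ = subst (_< n) (+-suc q o) lt

module _ {a b c : ℕ} where
  open Heights a b c
  open Arrays a b

  array-pp : ∀ {N} → IsHeight N → Entries c (array (pp N))
  array-pp {N} H i j =
      subst (_≤ c) (sym (entry-array (pp N) i j)) (cnt≤ (ppᵇ N (toℕ i) (toℕ j)) c)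
    , (λ j′ l → subst₂ _≤_ (sym (entry-array (pp N) i j′)) (sym (entry-array (pp N) i j))
        (decreasing (pp N (toℕ i)) b (pp-row (toℕ<n i)) l (toℕ<n j′)))
    , (λ i′ l → subst₂ _≤_ (sym (entry-array (pp N) i′ j)) (sym (entry-array (pp N) i j))
        (decreasing (λ p → pp N p (toℕ j)) a (λ hp → pp-column hp (toℕ<n j)) l (toℕ<n i′)))
    where open HeightToPP H

-- The correspondence

cast-injective : ∀ {n n′} (e : n ≡ n′) {r s} → Fin.cast e r ≡ Fin.cast e s → r ≡ s
cast-injective e {r} {s} eq = toℕ-injective (trans (sym (toℕ-cast e r)) (trans (cong toℕ eq) (toℕ-cast e s)))

coeffMul-01 : ∀ μ ν → coeffMul μ ν ≡ + 0 ⊎ coeffMul μ ν ≡ + 1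
coeffMul-01 μ ν with coeffMul-cases μ ν
... | inj₁ h       = inj₁ h
... | inj₂ (h , _) = inj₂ h

module Correspondence (a b c m d : ℕ) (0<a : 0 < a) (m+2 : 2 + m ≡ a + b + c)
  (L H : List Monomial) (Lₛ : AllPairs _≺_ L) (Hₛ : AllPairs _≺_ H) (e : length L ≡ length H)
  (L⁺ : ∀ {i j k} → i < a + b → j < a + c → k < b + c → i + j + k ≡ m → (i , j , k) ∈ L)
  (L⁻ : ∀ {i j k} → (i , j , k) ∈ L → i < a + b × j < a + c × k < b + c × i + j + k ≡ m)
  (H⁺ : ∀ {i j k} → i < a + b → j < a + c → k < b + c → i + j + k ≡ suc m → (i , j , k) ∈ H)
  (H⁻ : ∀ {i j k} → (i , j , k) ∈ H → i < a + b × j < a + c × k < b + c × i + j + k ≡ suc m)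
  (position : ∀ r s → List.lookup H s ≡ move X (List.lookup L r) → toℕ s ≡ d + toℕ r)
  where

  open Arrays a b
  open Matchings a b c m 0<a m+2 L H (AllPairs.map ≺⇒≢ Lₛ) (AllPairs.map ≺⇒≢ Hₛ) e L⁺ L⁻ H⁺ H⁻

  -- When `L` and `H` are the monomial bases, this is `Usq a b c e` by definition.
  M : Matrix (length L)
  M r s = coeffMul (List.lookup L r) (List.lookup H (Fin.cast e s))

  M01 : ∀ r s → M r s ≡ + 0 ⊎ M r s ≡ + 1
  M01 r s = coeffMul-01 (List.lookup L r) (List.lookup H (Fin.cast e s))

  shadow : Vec (Fin (length L)) (length L) → Fin (length L) → Fin (length H)
  shadow σ r = Fin.cast e (lookup σ r)

  matching : ∀ σ → T (nonzeroᵇ M σ) → IsMatching (shadow σ)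
  matching σ t = record
    { injective = λ eq → isPerm⁻ σ (proj₁ nz) (cast-injective e eq)
    ; adjacent  = adjacent
    }
    where
    nz : T (isPermᵇ σ) × (∀ r → M r (lookup σ r) ≡ + 1)
    nz = nonzero⁻ M M01 σ t
    adjacent : ∀ r → Σ Dir λ D → List.lookup H (shadow σ r) ≡ move D (List.lookup L r)
    adjacent r with coeffMul-cases (List.lookup L r) (List.lookup H (shadow σ r))
    ... | inj₂ (_ , w) = w
    ... | inj₁ z with () ← trans (sym z) (proj₂ nz r)

  heightOf : ∀ σ → T (nonzeroᵇ M σ) → ℕ → ℕ → ℕ
  heightOf σ t = flux (IsMatching.grid (matching σ t))

  heightOf-isHeight : ∀ σ (t : T (nonzeroᵇ M σ)) → IsHeight (heightOf σ t)
  heightOf-isHeight σ t = IsFlow.isHeight (IsMatching.isFlow (matching σ t))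

  toPP : NonzeroTerm M → PlanePartition a b c
  toPP (σ , t) = array (pp (heightOf σ t)) , isPPᵇ⁺ c (array (pp (heightOf σ t)))
      (array-pp (heightOf-isHeight σ t))

  -- The array determines the heights, by `height≡` for both matchings with the same `g`; the
  -- heights determine the directions, by `dir-flux`; and the directions determine `σ`.
  toPP-injective : ∀ {x y} → toPP x ≡ toPP y → x ≡ y
  toPP-injective {σ , t} {τ , t′} eq = Σ-T-≡ (nonzeroᵇ M) (Vec-ext λ r → cast-injective e
    (lookup-injective (AllPairs.map ≺⇒≢ Hₛ) (trans (proj₂ (Mσ.adjacent r))
        (trans (cong (λ D → move D (List.lookup L r)) (way≡ r)) (sym (proj₂ (Mτ.adjacent r)))))))
    where
    module Mσ = IsMatching (matching σ t)
    module Mτ = IsMatching (matching τ t′)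
    g : ℕ → ℕ → ℕ
    g = at (array (pp (heightOf σ t)))
    g-isPP : IsPP g
    g-isPP = at-isPP c (array (pp (heightOf σ t))) (array-pp (heightOf-isHeight σ t))
    heights≡ : ∀ {i j} → i ≤ a + b → j ≤ a + c → heightOf σ t i j ≡ heightOf τ t′ i j
    heights≡ hi hj = trans
      (sym (HeightToPP.height≡ (heightOf-isHeight σ t) (at-array (pp (heightOf σ t))) g-isPP hi hj))
      (HeightToPP.height≡ (heightOf-isHeight τ t′)
        (λ {p} {q} hp hq → trans (cong (λ π → at π p q) (cong proj₁ eq)) (at-array (pp (heightOf τ t′)) hp hq))
            g-isPP hi hj)
    way≡ : ∀ r → Mσ.way r ≡ Mτ.way r
    way≡ r with L⁻ (∈-lookup {xs = L} r)
    ... | i< , j< , _ = trans (sym (Mσ.grid-in r refl))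
      (trans (trans (sym (dir-flux Mσ.isFlow (λ _ _ → refl) i< j<)) (dir-flux Mτ.isFlow heights≡ i< j<))
          (Mτ.grid-in r refl))

  -- The preimage is the matching built from `height g`. Its evidence is rebuilt from the matrix
  -- entries, so `grid-unique` leads back to the grid of `match`, `flux-dir` to `height g`, and
  -- `pp-height` to the given entries.
  toPP-surjective : ∀ y → ∃ λ x → toPP x ≡ y
  toPP-surjective (π , t) = (σ , nz) , Σ-T-≡ (isPPᵇ c) (array-ext λ i j →
      trans (entry-array (pp (heightOf σ nz)) i j)
          (trans (pp≡ (toℕ<n i) (toℕ<n j)) (trans (pp-height g-isPP (toℕ<n i) (toℕ<n j)) (at-entry π i j))))
    where
    g : ℕ → ℕ → ℕ
    g = at π
    g-isPP : IsPP g
    g-isPP = at-isPP c π (isPPᵇ⁻ c π t)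
    N-isHeight : IsHeight (height g)
    N-isHeight = PPToHeight.isHeight g-isPP
    open HeightToMatching N-isHeight
    σ : Vec (Fin (length L)) (length L)
    σ = tabulate (λ r → Fin.cast (sym e) (match r))
    shadow≡match : ∀ r → shadow σ r ≡ match r
    shadow≡match r = trans (cong (Fin.cast e) (lookup∘tabulate (λ r → Fin.cast (sym e) (match r)) r))
        (cast-involutive e (sym e) (match r))
    nz : T (nonzeroᵇ M σ)
    nz = nonzero⁺ M M01 σ
      (isPerm⁺ σ λ {r} {s} eq → IsMatching.injective isMatching
          (trans (sym (shadow≡match r)) (trans (cong (Fin.cast e) eq) (shadow≡match s))))
      (λ r → subst (λ ν → coeffMul (List.lookup L r) ν ≢ + 0)
          (sym (trans (cong (List.lookup H) (shadow≡match r)) (match-adjacent r)))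
               (coeffMul-move (dirᴹ (List.lookup L r)) (List.lookup L r)))
    N≡ : ∀ {i j} → i ≤ a + b → j ≤ a + c → heightOf σ nz i j ≡ height g i j
    N≡ hi hj = trans (flux-cong (λ {i} {j} i< j< →
        trans (grid-unique (matching σ nz) isMatching shadow≡match i j) (grid≡dir i< j<)) hi hj)
                     (flux-dir N-isHeight hi hj)
    pp≡ : ∀ {p q} → p < a → q < b → pp (heightOf σ nz) p q ≡ pp (height g) p q
    pp≡ {p} {q} hp hq = cnt-cong c λ t _ → cong (p <ᵇ_)
        (N≡ (HeightToPP.i≤ N-isHeight p hq) (HeightToPP.j≤ N-isHeight t hp))

  correspondence : NonzeroTerm M ⤖ PlanePartition a b c
  correspondence = mk⤖ (toPP-injective , strictlySurjective⇒surjective toPP-surjective)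

  K₁ K₂ : ℕ
  K₁ = sum (λ r → level₁ (List.lookup L r) * d)
  K₂ = sum (λ s → level₁ (List.lookup H s) * d)

  inversions-constant : ∀ σ → T (nonzeroᵇ M σ) → inversions σ ≡ K₂ ∸ K₁
  inversions-constant σ t = trans (sym (m+n∸n≡m (inversions σ) K₁))
      (cong (_∸ K₁) (trans (cong (λ u → u + K₁) inv≡) inv-total))
    where
    open IsMatching (matching σ t)
    open Signs L H Lₛ Hₛ m d (λ r → proj₂ (proj₂ (proj₂ (L⁻ (∈-lookup {xs = L} r)))))
        (λ s → proj₂ (proj₂ (proj₂ (H⁻ (∈-lookup {xs = H} s)))))
      position (shadow σ) injective (injective⇒surjective e injective) way (proj₂ ∘ adjacent)
    inv≡ : inversions σ ≡ sum (λ r → sum (bit ∘ invᵇ (shadow σ) r))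
    inv≡ = trans (inversions≡sum σ) (sum-cong-≗ λ r → sum-cong-≗ λ s →
      cong₂ (λ u v → bit ((toℕ r <ᵇ toℕ s) ∧ (u <ᵇ v))) (sym (toℕ-cast e (lookup σ s)))
          (sym (toℕ-cast e (lookup σ r))))

  count : countᵇ (nonzeroᵇ M) (allVecs (length L) (length L)) ≡ numPP a b c
  count = count-bijection (nonzeroᵇ M) (isPPᵇ c) (allVecs-unique _ _) (allArrays-unique c a b)
      (λ σ _ → allVecs-∈ σ)
    (λ π t → allArrays-∈ π λ i j → proj₁ (isPPᵇ⁻ c π t i j)) correspondence

  det≡ : det M ≡ perm M ⊎ det M ≡ - perm M
  det≡ with minusOnePow-±1 (K₂ ∸ K₁)
  ... | inj₁ s = inj₁ (trans (det≡±perm M M01 (K₂ ∸ K₁) inversions-constant)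
      (trans (cong (λ u → u ℤ.* perm M) s) (ℤₚ.*-identityˡ (perm M))))
  ... | inj₂ s = inj₂ (trans (det≡±perm M M01 (K₂ ∸ K₁) inversions-constant)
      (trans (cong (λ u → u ℤ.* perm M) s) (ℤₚ.-1*i≡-i (perm M))))

  ∣det∣≡ : ∣ det M ∣ ≡ numPP a b c
  ∣det∣≡ = trans ∣det∣≡∣perm∣ (trans (cong ∣_∣ (perm≡count M M01)) count)
    where
    ∣det∣≡∣perm∣ : ∣ det M ∣ ≡ ∣ perm M ∣
    ∣det∣≡∣perm∣ with det≡
    ... | inj₁ h = cong ∣_∣ h
    ... | inj₂ h = trans (cong ∣_∣ h) (ℤₚ.∣-i∣≡∣i∣ (perm M))

-- Specialisation to the bases of degrees m and m + 1

module Hexagon (a b c : ℕ) (0<a : 0 < a) (0<b : 0 < b) where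

  m n A B C : ℕ
  m = deg a b c
  n = pred (a + b)
  A = a + b
  B = a + c
  C = b + c

  -- `deg` is a truncated difference, and positivity of `a` and `b` makes it exact.
  m+2 : 2 + m ≡ a + b + c
  m+2 = m+[n∸m]≡n (≤-trans (+-mono-≤ 0<a 0<b) (m≤m+n (a + b) c))

  A≡ : A ≡ suc n
  A≡ = sym (suc-pred A {{>-nonZero (≤-trans 0<a (m≤m+n a b))}})

  total : m + suc m + 3 ≡ A + B + C
  total = socle-degree m a b c m+2

  square : rowsN a b c ≡ colsN a b c
  square = ≤-antisym (Dual.dual-≤ A B C total) (Dual.dual-≤ A B C
      (trans (cong (λ u → u + 3) (+-comm (suc m) m)) total))

  source : ∀ μ → μ ∈ basis a b c m → move X μ ∈ basis a b c (suc m) → μ ∈ Slabs.slab B C m n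
  source (i , j , k) p q = go (Slabs.∈-slab⁻ B C m A p) (Slabs.∈-slab⁻ B C (suc m) A q)
    where
    go : i < A × j < B × k < C × i + j + k ≡ m → suc i < A × j < B × k < C × suc i + j + k ≡ suc m →
         (i , j , k) ∈ Slabs.slab B C m n
    go (_ , j< , k< , sum) (i< , _) = Slabs.∈-slab⁺ B C m n (s≤s⁻¹ (subst (suc i <_) A≡ i<)) j< k< sum

  -- The first `n` levels are a prefix of the basis in degree `m`, and their x-multiples are all of
  -- degree `m + 1` behind level 0. By `source` an x-edge starts in that prefix, since on the last
  -- level the x-move vanishes.
  position : ∀ r s → List.lookup (basis a b c (suc m)) s ≡ move X (List.lookup (basis a b c m) r) →
             toℕ s ≡ length (Slabs.slice B C (suc m) 0) + toℕ r
  position r s eq = index-shift shiftX (Slabs.slab B C m n) (Slabs.slice B C m n ++ [])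
      (Slabs.slice B C (suc m) 0)
    (trans (cong (Slabs.slab B C m) A≡) (Slabs.slab-suc B C m n))
        (trans (cong (Slabs.slab B C (suc m)) A≡) (slab-shift B C m n)) (Slabs.slab-unique B C m A)
          (Slabs.slab-unique B C (suc m) A)
    (source (List.lookup (basis a b c m) r) (∈-lookup {xs = basis a b c m} r)
      (subst (_∈ basis a b c (suc m)) eq (∈-lookup {xs = basis a b c (suc m)} s)))
    refl eq

  module Corr = Correspondence a b c m (length (Slabs.slice B C (suc m) 0)) 0<a m+2 (basis a b c m)
      (basis a b c (suc m))
    (Slabs.slab-sorted B C m A) (Slabs.slab-sorted B C (suc m) A) square
    (Slabs.∈-slab⁺ B C m A) (Slabs.∈-slab⁻ B C m A) (Slabs.∈-slab⁺ B C (suc m) A) (Slabs.∈-slab⁻ B C (suc m) A)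
        position

theorem1p2 : (a b c : ℕ) → 0 < a → 0 < b → 0 < c →
    Σ (rowsN a b c ≡ colsN a b c) λ e →
    ((r : Fin (rowsN a b c)) (s : Fin (colsN a b c)) →
    (U a b c r s ≡ + 0) ⊎ (U a b c r s ≡ + 1))
    × ((det (Usq a b c e) ≡ perm (Usq a b c e))
    ⊎ (det (Usq a b c e) ≡ - perm (Usq a b c e)))
    × (NonzeroTerm (Usq a b c e) ⤖ PlanePartition a b c)
    × (∣ det (Usq a b c e) ∣ ≡ numPP a b c)
theorem1p2 a b c 0<a 0<b _ =
    square
  , (λ r s → coeffMul-01 (List.lookup (basis a b c m) r) (List.lookup (basis a b c (suc m)) s))
  , Corr.det≡
  , Corr.correspondence
  , Corr.∣det∣≡
  where open Hexagon a b c 0<a 0<b
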